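{- For any constant integer $r\geq 2$, a $(2,r)$-ruling set of an $n$-vertex graph with maximum degree $\Delta$ can be computed deterministically in the \textsf{CONGEST} model in $O(\Delta^{2/(r+2)})+\log^* n$ rounds.
   Context: For an integer $r\geq1$, a $(2,r)$-ruling set of a graph $G=(V,E)$ is a set $S\subseteq V$ that is independent in $G$ and such that every vertex $v\in V$ is within hop distance at most $r$ of some vertex of $S$. The \textsf{CONGEST} model: synchronous rounds on the network graph, each vertex may send one $O(\log n)$-bit message per neighbor per round; vertices have unique $O(\log n)$-bit identifiers; at the end each vertex knows whether it belongs to $S$. $\log^* n$ is the iterated logarithm. -}

module Defs where

open import Data.Nat using (ℕ; zero; suc; _+_; _*_; _^_; _≤_; _<_; _⊔_; _≤ᵇ_)
open import Data.Nat.Logarithm using (⌊log₂_⌋; ⌈log₂_⌉)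
open import Data.Bool using (Bool; true; false; if_then_else_)
open import Data.Fin using (Fin)
open import Data.List using (List; map; allFin; foldr)
open import Data.Nat.ListAction using (sum)
open import Data.List.Membership.Propositional using (_∈_)
open import Data.List.Relation.Unary.Unique.Propositional using (Unique)
open import Data.Product using (Σ; _×_; _,_; ∃)
open import Function.Bundles using (_⇔_)
open import Relation.Binary.PropositionalEquality using (_≡_)

record Graph (n : ℕ) : Set where
  field
    adj   : Fin n → Fin n → Bool
    sym   : ∀ u v → adj u v ≡ adj v u
    irrefl : ∀ v → adj v v ≡ false
open Graph public

degree : ∀ {n} → Graph n → Fin n → ℕ
degree {n} G v = sum (map (λ u → if adj G v u then 1 else 0) (allFin n))

maxDegree : ∀ {n} → Graph n → ℕ
maxDegree {n} G = foldr _⊔_ 0 (map (degree G) (allFin n))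

data WithinHops {n : ℕ} (G : Graph n) : ℕ → Fin n → Fin n → Set where
  here : ∀ {k u} → WithinHops G k u u
  step : ∀ {k u w v} → adj G u w ≡ true → WithinHops G k w v →
         WithinHops G (suc k) u v

IsRulingSet : ∀ {n} → Graph n → ℕ → (Fin n → Bool) → Set
IsRulingSet {n} G r S =
  (∀ u v → S u ≡ true → S v ≡ true → adj G u v ≡ false) ×
  (∀ v → Σ (Fin n) λ u → S u ≡ true × WithinHops G r u v)

logStar-go : ℕ → ℕ → ℕ
logStar-go zero m = 0
logStar-go (suc fuel) m = if m ≤ᵇ 1 then 0 else suc (logStar-go fuel ⌊log₂ m ⌋)

logStar : ℕ → ℕ
logStar n = logStar-go n n

-- Deterministic CONGEST algorithms.
-- Every vertex initially knows n, Δ, its own identifier and the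
-- identifiers of its neighbours (in the order of its ports).  In each
-- round every vertex sends a message (a natural number) to each
-- neighbour, computed from its state and the neighbour's identifier,
-- then updates its state from the list of (sender id , message) pairs
-- received (in port order).  Local computation is unbounded.  All
-- vertices run for  rounds n Δ  rounds and then output a bit.

record CongestAlg : Set₁ where
  field
    State  : Set
    init   : (n Δ myId : ℕ) → List ℕ → State
    send   : State → ℕ → ℕ
    recv   : State → List (ℕ × ℕ) → State
    output : State → Bool
    rounds : ℕ → ℕ → ℕ
open CongestAlg public

IsPortNumbering : ∀ {n} → Graph n → (Fin n → List (Fin n)) → Set
IsPortNumbering {n} G ports =
  ∀ v → Unique (ports v) × (∀ u → (u ∈ ports v) ⇔ (adj G v u ≡ true))

module _ (A : CongestAlg) {n : ℕ} (G : Graph n) (ids : Fin n → ℕ)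
         (ports : Fin n → List (Fin n)) where

  stateAt : ℕ → Fin n → State A
  stateAt zero v = init A n (maxDegree G) (ids v) (map ids (ports v))
  stateAt (suc t) v =
    recv A (stateAt t v) (map (λ u → ids u , send A (stateAt t u) (ids v)) (ports v))

  BandwidthOK : ℕ → ℕ → Set
  BandwidthOK B T = ∀ t → t < T → ∀ v u → adj G u v ≡ true →
    send A (stateAt t u) (ids v) < 2 ^ (B * (1 + ⌈log₂ n ⌉))

  finalOutput : Fin n → Bool
  finalOutput v = output A (stateAt (rounds A n (maxDegree G)) v)

-- Linial's reduction leaves a colouring with Δ^O(1) colours after log* n + O(1) rounds. Write T for Δ^(2/(r+2)) and
-- W for T^(r/2), so that Δ ≤ W T. A vertex with colour ψ owns a polynomial f over a prime field whose coefficients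
-- are the digits of ψ, and two polynomials of different neighbours meet in O(1) points.
-- Over a field of size q = O(T), the vertices try the classes f(0), f(1), … one after the other, and a vertex joins a
-- class as soon as at most W neighbours conflict with this; a vertex meets O(Δ) conflicts in total, so after q rounds
-- all have joined, and the neighbours in the same class that did not join later number at most W.
-- Over a field of size s = O(W), the classes then choose final colours (x , f(x) + c) one class after the other.
-- The lines c partition the s² colours, so for some c at most Δ/s ≤ W of the points are taken by earlier classes, and
-- the O(W) points where f + c meets the curve of a relevant neighbour in the same class leave a free x.
-- The resulting s² = O(T)^r colours are read as r digits in base O(T), and each digit costs O(T) rounds and
-- one unit of distance: the vertices left over form a maximal independent set among those that agree in the
-- remaining digits.
-- The primes come from a form of Bertrand's postulate with a worse constant.
module Submission where

open import Defs renaming (sym to adj-sym; here to stay; step to hop)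
open import Data.Bool using (Bool; true; false; if_then_else_; T; _∧_; _∨_)
open import Data.Empty using (⊥)
open import Data.Fin using (Fin)
open import Data.Integer using (ℤ; +_)
import Data.Integer as ℤ
import Data.Integer.Divisibility.Signed as ℤ
import Data.Integer.Properties as ℤ
import Data.Integer.Tactic.RingSolver as ℤ
open import Data.List using (List; []; _∷_; _++_; length; map; foldr; allFin)
open import Data.List.Membership.Propositional using (_∈_)
open import Data.List.Membership.Propositional.Properties using (∈-allFin; ∈-∃++; ∈-++⁻; ∈-++⁺ˡ; ∈-++⁺ʳ)
open import Data.List.Properties using (map-cong; map-∘; map-++; length-tabulate; length-++)
open import Data.List.Relation.Unary.All using (All; []; _∷_)
import Data.List.Relation.Unary.All as All
open import Data.List.Relation.Unary.AllPairs using ([]; _∷_)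
open import Data.List.Relation.Unary.Any using (here; there)
open import Data.List.Relation.Unary.Unique.Propositional using (Unique)
open import Data.Nat
open import Data.Nat.DivMod
open import Data.Nat.Divisibility hiding (quotient)
open import Data.Nat.Induction using (<-wellFounded)
open import Data.Nat.ListAction using (sum; product)
open import Data.Nat.ListAction.Properties using (sum-++)
open import Data.Nat.Logarithm using (⌊log₂_⌋; ⌈log₂_⌉; ⌊log₂⌋-mono-≤; ⌊log₂[2^n]⌋≡n)
open import Data.Nat.Logarithm.Core using (⌈log2⌉)
open import Data.Nat.Primality
open import Data.Nat.Primality.Factorisation using (factorise; module PrimeFactorisation)
open import Data.Nat.Properties
open import Data.Nat.Tactic.RingSolver using (solve-∀)
open import Data.Product using (Σ; ∃; _×_; _,_; proj₁; proj₂)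
open import Data.Sum using (_⊎_; inj₁; inj₂)
open import Data.Unit using (tt)
open import Function using (_∘_)
open import Function.Bundles using (Equivalence)
open import Function.Definitions using (Injective)
open import Induction.WellFounded using (Acc; acc)
open import Relation.Binary.Definitions using (tri<; tri≈; tri>)
open import Relation.Binary.PropositionalEquality using (_≡_; _≢_; refl; sym; trans; cong; cong₂; subst; module ≡-Reasoning)
open import Relation.Nullary using (¬_; Dec; yes; no; contradiction)
open import Relation.Nullary.Decidable using (_×-dec_)

-- A proper colouring with b^r colours yields the ruling set in about r b rounds, so the task is to
-- reach O(T)^r colours within O(T) rounds. Inside one class of outdegree W, a single polynomial
-- step would do with O(W²) colours; W² = T^r together with W T = Δ forces T^(r+2) = Δ², the origin
-- of the exponent. The obstacle is that separate palettes for the O(T) classes would cost another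
-- factor T. The classes therefore share one palette, and the translation c is the extra freedom
-- that keeps a class away from the points taken before it. For this purpose all polynomials have
-- constant term zero: curves of different colours then meet in few points under any translations,
-- and the translates of a single curve are disjoint. Constants are the curves of the colour 0,
-- which is why colours are kept positive. Constant factors in the field sizes are harmless, so a
-- crude comparison of lcm(1, ..., 2 m) with a power of a factorial times a primorial is enough to
-- find the primes.

-- Bertrand's postulate up to a constant factor

-- The binomial coefficient of m + k over m.
binom : ℕ → ℕ → ℕ
binom zero    k       = 1
binom (suc m) zero    = 1
binom (suc m) (suc k) = binom m (suc k) + binom (suc m) k

binom-! : ∀ m k → binom m k * (m ! * k !) ≡ (m + k) !
binom-! zero    k       = trans (*-identityˡ _) (*-identityˡ _)
binom-! (suc m) zero    = trans (*-identityˡ _) (trans (*-identityʳ _) (cong _! (sym (+-identityʳ (suc m)))))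
binom-! (suc m) (suc k) = begin
  (a + b) * (suc m * m ! * (suc k * k !))                   ≡⟨ lemma a b m k (m !) (k !) ⟩
  suc m * (a * (m ! * (suc k * k !))) + suc k * (b * (suc m * m ! * k !))
    ≡⟨ cong₂ (λ x y → suc m * x + suc k * y) (binom-! m (suc k)) (binom-! (suc m) k) ⟩
  suc m * (m + suc k) ! + suc k * (suc m + k) !             ≡⟨ cong (λ z → suc m * (m + suc k) ! + suc k * z !) (sym (+-suc m k)) ⟩
  suc m * (m + suc k) ! + suc k * (m + suc k) !             ≡⟨ sym (*-distribʳ-+ ((m + suc k) !) (suc m) (suc k)) ⟩
  (suc m + suc k) * (m + suc k) ! ∎
  where
  open ≡-Reasoning
  a b : ℕ
  a = binom m (suc k)
  b = binom (suc m) k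
  lemma : ∀ a b m k x y → (a + b) * (suc m * x * (suc k * y))
        ≡ suc m * (a * (x * (suc k * y))) + suc k * (b * (suc m * x * y))
  lemma = solve-∀

binom-pos : ∀ m k → 1 ≤ binom m k
binom-pos zero    k       = ≤-refl
binom-pos (suc m) zero    = ≤-refl
binom-pos (suc m) (suc k) = ≤-trans (binom-pos m (suc k)) (m≤m+n _ _)

binom≤2^ : ∀ m k → binom m k ≤ 2 ^ (m + k)
binom≤2^ zero    k       = m^n>0 2 k
binom≤2^ (suc m) zero    = m^n>0 2 (suc m + 0)
binom≤2^ (suc m) (suc k) = begin
  binom m (suc k) + binom (suc m) k       ≤⟨ +-mono-≤ (binom≤2^ m (suc k)) (binom≤2^ (suc m) k) ⟩
  2 ^ (m + suc k) + 2 ^ (suc m + k)       ≡⟨ cong (λ z → 2 ^ (m + suc k) + 2 ^ z) (sym (+-suc m k)) ⟩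
  2 ^ (m + suc k) + 2 ^ (m + suc k)       ≡⟨ cong (λ z → 2 ^ (m + suc k) + z) (sym (+-identityʳ _)) ⟩
  2 ^ (suc m + suc k) ∎
  where open ≤-Reasoning

2^≤binom : ∀ m → 2 ^ m ≤ binom m m
2^≤binom zero    = ≤-refl
2^≤binom (suc m) = begin
  2 * 2 ^ m                          ≡⟨ cong (λ z → 2 ^ m + z) (+-identityʳ _) ⟩
  2 ^ m + 2 ^ m                      ≤⟨ +-mono-≤ (2^≤binom m) (2^≤binom m) ⟩
  binom m m + binom m m              ≤⟨ +-mono-≤ (left m m) (right m m) ⟩
  binom m (suc m) + binom (suc m) m  ∎
  where
  open ≤-Reasoning
  left : ∀ m k → binom m k ≤ binom m (suc k)
  left zero    k = ≤-refl
  left (suc m) k = m≤n+m _ _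
  right : ∀ m k → binom m k ≤ binom (suc m) k
  right m zero    = ≤-reflexive (binom-zero m)
    where
    binom-zero : ∀ m → binom m 0 ≡ 1
    binom-zero zero    = refl
    binom-zero (suc m) = refl
  right m (suc k) = m≤m+n _ _

private
  cancel-!! : ∀ m k {x y} → x * (m ! * k !) ≡ y * (m ! * k !) → x ≡ y
  cancel-!! m k = *-cancelʳ-≡ _ _ (m ! * k !) {{m !* k !≢0}}

binom-absorbʳ : ∀ m k → binom m (suc k) * suc k ≡ suc (m + k) * binom m k
binom-absorbʳ m k = cancel-!! m k (trans (lemma (binom m (suc k)) k (m !) (k !))
  (trans (binom-! m (suc k)) (trans (cong _! (+-suc m k))
  (trans (cong (suc (m + k) *_) (sym (binom-! m k))) (sym (*-assoc (suc (m + k)) (binom m k) _))))))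
  where
  lemma : ∀ b k x y → b * suc k * (x * y) ≡ b * (x * (suc k * y))
  lemma = solve-∀

binom-absorbˡ : ∀ m k → binom (suc m) k * suc m ≡ suc (m + k) * binom m k
binom-absorbˡ m k = cancel-!! m k (trans (lemma (binom (suc m) k) m (m !) (k !))
  (trans (binom-! (suc m) k)
  (trans (cong (suc (m + k) *_) (sym (binom-! m k))) (sym (*-assoc (suc (m + k)) (binom m k) _)))))
  where
  lemma : ∀ b m x y → b * suc m * (x * y) ≡ b * (suc m * x * y)
  lemma = solve-∀

-- Leibniz's harmonic triangle: 1 / ((m + 1) binom (m + 1) k) is the difference of the entries
-- 1 / (m binom m k) and 1 / (m binom m (k + 1)), so every entry is an integer combination of 1 / 1, …, 1 / n.
common-multiple : ∀ L m k → (∀ i → 1 ≤ i → i ≤ suc m + k → i ∣ L) → suc m * binom (suc m) k ∣ L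
common-multiple L zero k h = subst (_∣ L) (sym (trans (*-identityˡ _) (one k))) (h (suc k) (s≤s z≤n) ≤-refl)
  where
  one : ∀ k → binom 1 k ≡ suc k
  one zero    = refl
  one (suc k) = cong suc (one k)
common-multiple L (suc m) k h with common-multiple L m k (λ i p q → h i p (m≤n⇒m≤1+n q))
                                 | common-multiple L m (suc k) (λ i p q → h i p (≤-trans q (≤-reflexive (+-suc (suc m) k))))
... | divides α eα | divides β eβ = ∣m+n∣m⇒∣n (divides α lhs) (divides β refl)
  where
  open ≡-Reasoning
  c : ℕ
  c = suc (suc m) * binom (suc (suc m)) k
  u w : ℕ
  u = binom (suc m) k
  w = binom (suc m) (suc k)
  c≡u : c ≡ suc (suc m + k) * u
  c≡u = trans (*-comm (suc (suc m)) (binom (suc (suc m)) k)) (binom-absorbˡ (suc m) k)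
  c≡w : c ≡ w * suc k
  c≡w = trans c≡u (sym (binom-absorbʳ (suc m) k))
  cancelled : L * suc (suc m + k) ≡ α * suc m * c
  cancelled = begin
    L * suc (suc m + k)                  ≡⟨ cong (_* suc (suc m + k)) eα ⟩
    α * (suc m * u) * suc (suc m + k)    ≡⟨ solve-lemma α m u (suc (suc m + k)) ⟩
    α * suc m * (suc (suc m + k) * u)    ≡⟨ cong (α * suc m *_) (sym c≡u) ⟩
    α * suc m * c ∎
    where
    solve-lemma : ∀ a m u d → a * (suc m * u) * d ≡ a * suc m * (d * u)
    solve-lemma = solve-∀
  cancelled′ : L * suc k ≡ β * suc m * c
  cancelled′ = begin
    L * suc k                  ≡⟨ cong (_* suc k) eβ ⟩
    β * (suc m * w) * suc k    ≡⟨ solve-lemma β m w (suc k) ⟩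
    β * suc m * (w * suc k)    ≡⟨ cong (β * suc m *_) (sym c≡w) ⟩
    β * suc m * c ∎
    where
    solve-lemma : ∀ a m u d → a * (suc m * u) * d ≡ a * suc m * (u * d)
    solve-lemma = solve-∀
  lhs : β * c + L ≡ α * c
  lhs = *-cancelʳ-≡ _ _ (suc m) (begin
    (β * c + L) * suc m             ≡⟨ l1 β m c L ⟩
    β * suc m * c + L * suc m       ≡⟨ cong (_+ L * suc m) (sym cancelled′) ⟩
    L * suc k + L * suc m           ≡⟨ l2 L m k ⟩
    L * suc (suc m + k)             ≡⟨ cancelled ⟩
    α * suc m * c                   ≡⟨ l3 α m c ⟩
    α * c * suc m ∎)
    where
    l1 : ∀ β m c L → (β * c + L) * suc m ≡ β * suc m * c + L * suc m
    l1 = solve-∀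
    l2 : ∀ L m k → L * suc k + L * suc m ≡ L * suc (suc m + k)
    l2 = solve-∀
    l3 : ∀ α m c → α * suc m * c ≡ α * c * suc m
    l3 = solve-∀

-- A lower bound for lcm(1, ..., 2 m): by `common-multiple` it is divisible by a multiple of the
-- central binomial coefficient.
2^≤common-multiple : ∀ L m → .{{NonZero L}} → (∀ i → 1 ≤ i → i ≤ m + m → i ∣ L) → 2 ^ m ≤ L
2^≤common-multiple L zero    h = >-nonZero⁻¹ L
2^≤common-multiple L (suc m) h = begin
  2 ^ suc m                            ≤⟨ 2^≤binom (suc m) ⟩
  binom (suc m) (suc m)                ≤⟨ m≤m+n _ _ ⟩
  suc m * binom (suc m) (suc m)        ≤⟨ ∣⇒≤ (common-multiple L m (suc m) h) ⟩
  L ∎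
  where open ≤-Reasoning

timesIfPrime : ℕ → ℕ → ℕ
timesIfPrime n x with prime? n
... | yes _ = n * x
... | no  _ = x

-- The product of the primes in the interval from a + 1 to a + k.
primorial : ℕ → ℕ → ℕ
primorial a zero    = 1
primorial a (suc k) = timesIfPrime (a + suc k) (primorial a k)

primorial-+ : ∀ k l → primorial 0 (k + l) ≡ primorial k l * primorial 0 k
primorial-+ k zero    = trans (cong (primorial 0) (+-identityʳ k)) (sym (*-identityˡ _))
primorial-+ k (suc l) = begin
  primorial 0 (k + suc l)                                    ≡⟨ cong (primorial 0) (+-suc k l) ⟩
  timesIfPrime (suc (k + l)) (primorial 0 (k + l))           ≡⟨ cong₂ timesIfPrime (sym (+-suc k l)) (primorial-+ k l) ⟩
  timesIfPrime (k + suc l) (primorial k l * primorial 0 k)   ≡⟨ assoc (k + suc l) _ _ ⟩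
  timesIfPrime (k + suc l) (primorial k l) * primorial 0 k   ∎
  where
  open ≡-Reasoning
  assoc : ∀ n x y → timesIfPrime n (x * y) ≡ timesIfPrime n x * y
  assoc n x y with prime? n
  ... | yes _ = sym (*-assoc n x y)
  ... | no  _ = refl

primorial-pos : ∀ a k → 1 ≤ primorial a k
primorial-pos a zero = ≤-refl
primorial-pos a (suc k) with prime? (a + suc k)
... | yes p = *-mono-≤ {1} (>-nonZero⁻¹ _ {{prime⇒nonZero p}}) (primorial-pos a k)
... | no  _ = primorial-pos a k

prime∣primorial⇒≤ : ∀ {p} a k → Prime p → p ∣ primorial a k → p ≤ a + k
prime∣primorial⇒≤ a zero    pp d = contradiction (subst Prime (∣1⇒≡1 d) pp) ¬prime[1]
prime∣primorial⇒≤ {p} a (suc k) pp d with prime? (a + suc k)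
... | no  _ = ≤-trans (prime∣primorial⇒≤ a k pp d) (+-monoʳ-≤ a (n≤1+n k))
... | yes q with euclidsLemma (a + suc k) (primorial a k) pp d
...   | inj₁ e = ∣⇒≤ {{prime⇒nonZero q}} e
...   | inj₂ e = ≤-trans (prime∣primorial⇒≤ a k pp e) (+-monoʳ-≤ a (n≤1+n k))

prime∣primorial : ∀ {p} k → Prime p → p ≤ k → p ∣ primorial 0 k
prime∣primorial zero    pp z≤n = contradiction pp ¬prime[0]
prime∣primorial {p} (suc k) pp le with prime? (suc k) | m≤n⇒m<n∨m≡n le
... | yes _ | inj₁ (s≤s lt) = ∣n⇒∣m*n (suc k) (prime∣primorial k pp lt)
... | yes _ | inj₂ refl     = m∣m*n _
... | no  _ | inj₁ (s≤s lt) = prime∣primorial k pp lt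
... | no ¬q | inj₂ refl     = contradiction pp ¬q

-- The new prime `a + suc k` exceeds all prime divisors of `primorial a k`, so Euclid's lemma puts
-- it into the cofactor.
primorial∣ : ∀ a k X → (∀ p → Prime p → a < p → p ≤ a + k → p ∣ X) → primorial a k ∣ X
primorial∣ a zero    X h = 1∣ X
primorial∣ a (suc k) X h with prime? (a + suc k) | primorial∣ a k X (λ p pp lt le → h p pp lt (≤-trans le (+-monoʳ-≤ a (n≤1+n k))))
... | no  _ | d = d
... | yes q | divides z eq with euclidsLemma z (primorial a k) q (subst (a + suc k ∣_) eq (h _ q (m<m+n a (s≤s z≤n)) ≤-refl))
...   | inj₂ e = contradiction (prime∣primorial⇒≤ a k q e) (<⇒≱ (+-monoʳ-< a ≤-refl))
...   | inj₁ e = subst (_ ∣_) (sym eq) (*-monoˡ-∣ (primorial a k) e)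

prime∤! : ∀ {p} n → Prime p → n < p → ¬ (p ∣ n !)
prime∤! zero    pp lt d = ¬prime[1] (subst Prime (∣1⇒≡1 d) pp)
prime∤! (suc n) pp lt d with euclidsLemma (suc n) (n !) pp d
... | inj₁ e = <⇒≱ lt (∣⇒≤ e)
... | inj₂ e = prime∤! n pp (<-trans (n<1+n n) lt) e

≤⇒∣! : ∀ {i} n → 1 ≤ i → i ≤ n → i ∣ n !
≤⇒∣! zero    (s≤s _) ()
≤⇒∣! (suc n) 1≤i le with m≤n⇒m<n∨m≡n le
... | inj₁ (s≤s lt) = ∣n⇒∣m*n (suc n) (≤⇒∣! n 1≤i lt)
... | inj₂ refl     = m∣m*n _

-- A prime above m and at most 2 m divides `(m + m) !` but not `m !`, so by `binom-!` it survives in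
-- the binomial coefficient.
primorial∣binom : ∀ m → primorial m m ∣ binom m m
primorial∣binom m = primorial∣ m m _ λ p pp lt le → divide p pp lt le
  where
  divide : ∀ p → Prime p → m < p → p ≤ m + m → p ∣ binom m m
  divide p pp lt le with euclidsLemma (binom m m) (m ! * m !) pp
                           (subst (p ∣_) (sym (binom-! m m)) (≤⇒∣! (m + m) (≤-trans (s≤s z≤n) lt) le))
  ... | inj₁ d = d
  ... | inj₂ d with euclidsLemma (m !) (m !) pp d
  ...   | inj₁ e = contradiction e (prime∤! m pp lt)
  ...   | inj₂ e = contradiction e (prime∤! m pp lt)

-- The classical bound 4 ^ x for the product of the primes up to x, for powers of two only. Doubling
-- x adds primes whose product divides a central binomial coefficient.
primorial≤ : ∀ k → primorial 0 (2 ^ k) ≤ 2 ^ (2 ^ suc k)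
primorial≤ zero    = s≤s z≤n
primorial≤ (suc k) = begin
  primorial 0 (2 ^ suc k)                         ≡⟨ cong (primorial 0) 2m ⟩
  primorial 0 (2 ^ k + 2 ^ k)                     ≡⟨ primorial-+ (2 ^ k) (2 ^ k) ⟩
  primorial (2 ^ k) (2 ^ k) * primorial 0 (2 ^ k) ≤⟨ *-mono-≤ (≤-trans (∣⇒≤ {{>-nonZero (binom-pos (2 ^ k) (2 ^ k))}} (primorial∣binom (2 ^ k)))
                                                      (≤-trans (binom≤2^ (2 ^ k) (2 ^ k)) (≤-reflexive (cong (2 ^_) (sym 2m))))) (primorial≤ k) ⟩
  2 ^ (2 ^ suc k) * 2 ^ (2 ^ suc k)               ≡⟨ sym (^-distribˡ-+-* 2 (2 ^ suc k) (2 ^ suc k)) ⟩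
  2 ^ (2 ^ suc k + 2 ^ suc k)                     ≡⟨ cong (λ z → 2 ^ (2 ^ suc k + z)) (sym (+-identityʳ _)) ⟩
  2 ^ (2 ^ suc (suc k)) ∎
  where
  open ≤-Reasoning
  2m : 2 ^ suc k ≡ 2 ^ k + 2 ^ k
  2m = cong (λ z → 2 ^ k + z) (+-identityʳ _)

open PrimeFactorisation using (isFactorisation; factorsPrime)

-- Multiplying together prime factors, at most one of them can exceed R as long as the product is at most R * R.
product∣ : ∀ R P → (∀ p → Prime p → R < p → p ≤ R * R → p ∣ P) → ∀ ps → All Prime ps → product ps ≤ R * R →
  product ps ∣ (R !) ^ length ps ⊎ (product ps ∣ (R !) ^ length ps * P × R < product ps)
product∣ R P h []       []        le = inj₁ ∣-refl
product∣ R P h (p ∷ ps) (pp ∷ pps) le = extend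
  where
  instance
    p≢0 : NonZero p
    p≢0 = prime⇒nonZero pp
    ps≢0 : NonZero (product ps)
    ps≢0 = productOfPrimes≢0 pps
  tail≤ : product ps ≤ p * product ps
  tail≤ = m≤n*m (product ps) p
  swap : ∀ a b c → a * (b * c) ≡ b * (a * c)
  swap = solve-∀
  extend : product (p ∷ ps) ∣ (R !) ^ length (p ∷ ps) ⊎ (product (p ∷ ps) ∣ (R !) ^ length (p ∷ ps) * P × R < product (p ∷ ps))
  extend with p ≤? R | product∣ R P h ps pps (≤-trans tail≤ le)
  ... | yes p≤R | inj₁ d        = inj₁ (*-pres-∣ (≤⇒∣! R (>-nonZero⁻¹ p) p≤R) d)
  ... | yes p≤R | inj₂ (d , lt) = inj₂ (subst (p * product ps ∣_) (sym (*-assoc (R !) _ P)) (*-pres-∣ (≤⇒∣! R (>-nonZero⁻¹ p) p≤R) d)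
                                       , <-≤-trans lt tail≤)
  ... | no p≰R  | inj₁ d        = inj₂ (subst (p * product ps ∣_) (trans (swap P (R !) ((R !) ^ length ps)) (trans (cong (R ! *_) (*-comm P _)) (sym (*-assoc (R !) _ P))))
                                        (*-pres-∣ (h p pp (≰⇒> p≰R) (≤-trans (m≤m*n p (product ps)) le)) (∣n⇒∣m*n (R !) d))
                                       , <-≤-trans (≰⇒> p≰R) (m≤m*n p (product ps)))
  ... | no p≰R  | inj₂ (d , lt) = contradiction le (<⇒≱ (*-mono-< (≰⇒> p≰R) lt))

2^length≤product : ∀ ps → All Prime ps → 2 ^ length ps ≤ product ps
2^length≤product []       []         = ≤-refl
2^length≤product (p ∷ ps) (pp ∷ pps) = *-mono-≤ (nonTrivial⇒n>1 p {{prime⇒nonTrivial pp}}) (2^length≤product ps pps)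

!≤^ : ∀ R n → n ≤ R → n ! ≤ R ^ n
!≤^ R zero    le = ≤-refl
!≤^ R (suc n) le = *-mono-≤ le (!≤^ R n (≤-trans (n≤1+n n) le))

-- Without primes between 2 ^ a and 4 ^ j, every i up to 2 m divides L: it has at most 2 j prime
-- factors, those up to R divide `R !`, and the single one that may be larger divides P. The lower
-- bound 2 ^ m for common multiples then meets the upper bound from `R ! ≤ R ^ R` and `primorial≤`.
no-primes-bound : ∀ j a → (∀ p → Prime p → 2 ^ a < p → p ≤ 2 ^ j * 2 ^ j → ⊥) →
  ∀ m → m + m ≤ 2 ^ j * 2 ^ j → m ≤ j * 2 ^ j * (2 * j) + 2 ^ suc a
no-primes-bound j a none m 2m≤ = ≮⇒≥ λ lt → <⇒≱ (^-monoʳ-< 2 (s≤s (s≤s z≤n)) lt) upper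
  where
  open ≤-Reasoning
  R P L : ℕ
  R = 2 ^ j
  P = primorial 0 (2 ^ a)
  L = (R !) ^ (2 * j) * P
  instance
    R!≢0 : NonZero ((R !) ^ (2 * j))
    R!≢0 = m^n≢0 (R !) (2 * j) {{R !≢0}}
    P≢0 : NonZero P
    P≢0 = >-nonZero (primorial-pos 0 (2 ^ a))
    L≢0 : NonZero L
    L≢0 = m*n≢0 ((R !) ^ (2 * j)) P
  pow∣ : ∀ k l → k ≤ l → (R !) ^ k ∣ (R !) ^ l
  pow∣ k l k≤l = divides ((R !) ^ (l ∸ k)) (trans (cong ((R !) ^_) (sym (m∸n+n≡m k≤l))) (^-distribˡ-+-* (R !) (l ∸ k) k))
  large : ∀ p → Prime p → R < p → p ≤ R * R → p ∣ P
  large p pp _ le with p ≤? 2 ^ a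
  ... | yes q = prime∣primorial (2 ^ a) pp q
  ... | no  q = contradiction le (none p pp (≰⇒> q))
  multiple : ∀ i → 1 ≤ i → i ≤ m + m → i ∣ L
  multiple (suc i) 1≤i i≤ = subst (_∣ L) (sym eq) (conclude (product∣ R P large ps primes ps≤))
    where
    ps : List ℕ
    ps = PrimeFactorisation.factors (factorise (suc i))
    primes : All Prime ps
    primes = factorsPrime (factorise (suc i))
    eq : suc i ≡ product ps
    eq = isFactorisation (factorise (suc i))
    ps≤ : product ps ≤ R * R
    ps≤ = ≤-trans (≤-reflexive (sym eq)) (≤-trans i≤ 2m≤)
    len : length ps ≤ 2 * j
    len = ≮⇒≥ λ lt → <⇒≱ (^-monoʳ-< 2 (s≤s (s≤s z≤n)) lt) (begin
      2 ^ length ps      ≤⟨ 2^length≤product ps primes ⟩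
      product ps         ≤⟨ ps≤ ⟩
      2 ^ j * 2 ^ j      ≡⟨ sym (^-distribˡ-+-* 2 j j) ⟩
      2 ^ (j + j)        ≡⟨ cong (λ z → 2 ^ (j + z)) (sym (+-identityʳ j)) ⟩
      2 ^ (2 * j) ∎)
    conclude : _ ⊎ _ → product ps ∣ L
    conclude (inj₁ d)       = ∣m⇒∣m*n P (∣-trans d (pow∣ _ _ len))
    conclude (inj₂ (d , _)) = ∣-trans d (*-monoˡ-∣ P (pow∣ _ _ len))
  upper : 2 ^ m ≤ 2 ^ (j * 2 ^ j * (2 * j) + 2 ^ suc a)
  upper = begin
    2 ^ m                                            ≤⟨ 2^≤common-multiple L m multiple ⟩
    (R !) ^ (2 * j) * P                              ≤⟨ *-mono-≤ (^-monoˡ-≤ (2 * j) (!≤^ R R ≤-refl)) (primorial≤ a) ⟩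
    (R ^ R) ^ (2 * j) * 2 ^ (2 ^ suc a)              ≡⟨ cong (λ z → z ^ (2 * j) * 2 ^ (2 ^ suc a)) (^-*-assoc 2 j R) ⟩
    (2 ^ (j * R)) ^ (2 * j) * 2 ^ (2 ^ suc a)        ≡⟨ cong (_* 2 ^ (2 ^ suc a)) (^-*-assoc 2 (j * R) (2 * j)) ⟩
    2 ^ (j * R * (2 * j)) * 2 ^ (2 ^ suc a)          ≡⟨ sym (^-distribˡ-+-* 2 (j * R * (2 * j)) (2 ^ suc a)) ⟩
    2 ^ (j * R * (2 * j) + 2 ^ suc a) ∎

-- If there were no such prime, `no-primes-bound` with m = 32 Z² would give 32 Z² ≤ 16 Z j² + 8 Z²,
-- and `j * j ≤ Z` bounds the right side by 24 Z².
prime-between : ∀ j a Z → 1 ≤ Z → 2 ^ j ≡ 8 * Z → 2 ^ a ≡ 4 * (Z * Z) → j * j ≤ Z →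
  ∃ λ p → Prime p × 4 * (Z * Z) < p × p ≤ 64 * (Z * Z)
prime-between j a Z Z≥1 2^j≡ 2^a≡ j² with anyUpTo? (λ p → prime? p ×-dec (4 * (Z * Z) <? p)) (suc (64 * (Z * Z)))
... | yes (p , s≤s le , pp , lt) = p , pp , lt , le
... | no none = contradiction (no-primes-bound j a none′ (32 * (Z * Z)) (≤-reflexive m+m≡)) (<⇒≱ too-small)
  where
  open ≤-Reasoning
  64≡ : 2 ^ j * 2 ^ j ≡ 64 * (Z * Z)
  64≡ = trans (cong₂ _*_ 2^j≡ 2^j≡) (lemma Z)
    where
    lemma : ∀ z → 8 * z * (8 * z) ≡ 64 * (z * z)
    lemma = solve-∀
  m+m≡ : 32 * (Z * Z) + 32 * (Z * Z) ≡ 2 ^ j * 2 ^ j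
  m+m≡ = trans (sym (*-distribʳ-+ (Z * Z) 32 32)) (sym 64≡)
  none′ : ∀ p → Prime p → 2 ^ a < p → p ≤ 2 ^ j * 2 ^ j → ⊥
  none′ p pp lt le = none (p , s≤s (≤-trans le (≤-reflexive 64≡)) , pp , subst (_< p) 2^a≡ lt)
  too-small : j * 2 ^ j * (2 * j) + 2 ^ suc a < 32 * (Z * Z)
  too-small = begin-strict
    j * 2 ^ j * (2 * j) + 2 * 2 ^ a           ≡⟨ cong₂ (λ x y → j * x * (2 * j) + 2 * y) 2^j≡ 2^a≡ ⟩
    j * (8 * Z) * (2 * j) + 2 * (4 * (Z * Z)) ≡⟨ lemma j Z ⟩
    16 * Z * (j * j) + 8 * (Z * Z)            ≤⟨ +-monoˡ-≤ _ (*-monoʳ-≤ (16 * Z) j²) ⟩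
    16 * Z * Z + 8 * (Z * Z)                  ≡⟨ cong (_+ 8 * (Z * Z)) (*-assoc 16 Z Z) ⟩
    16 * (Z * Z) + 8 * (Z * Z)                ≡⟨ sym (*-distribʳ-+ (Z * Z) 16 8) ⟩
    24 * (Z * Z)                              <⟨ *-monoˡ-< (Z * Z) {{>-nonZero (*-mono-≤ Z≥1 Z≥1)}} (<ᵇ⇒< 24 32 _) ⟩
    32 * (Z * Z) ∎
    where
    lemma : ∀ j z → j * (8 * z) * (2 * j) + 2 * (4 * (z * z)) ≡ 16 * z * (j * j) + 8 * (z * z)
    lemma = solve-∀

-- Here 10 + k is the j of `weak-bertrand`. The case k = 0 is the critical one and asks for c ≥ 100;
-- the first such power of two is 2 ^ 7, hence `exponent`.
square≤2^ : ∀ c → 100 ≤ c → ∀ k → (10 + k) * (10 + k) ≤ c * 2 ^ k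
square≤2^ c 100≤c zero    = ≤-trans 100≤c (≤-reflexive (sym (*-identityʳ c)))
square≤2^ c 100≤c (suc k) = begin
  (10 + suc k) * (10 + suc k)                         ≤⟨ m≤m+n _ (79 + 18 * k + k * k) ⟩
  (10 + suc k) * (10 + suc k) + (79 + 18 * k + k * k) ≡⟨ expand k ⟩
  (10 + k) * (10 + k) * 2                             ≤⟨ *-monoˡ-≤ 2 (square≤2^ c 100≤c k) ⟩
  c * 2 ^ k * 2                                       ≡⟨ trans (*-assoc c (2 ^ k) 2) (cong (c *_) (*-comm (2 ^ k) 2)) ⟩
  c * 2 ^ suc k ∎
  where
  open ≤-Reasoning
  expand : ∀ k → (10 + suc k) * (10 + suc k) + (79 + 18 * k + k * k) ≡ (10 + k) * (10 + k) * 2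
  expand = solve-∀

log₄ : ∀ N → 1 ≤ N → ∃ λ k → 4 ^ k ≤ N × N < 4 ^ suc k
log₄ (suc zero)    _ = 0 , ≤-refl , s≤s (s≤s z≤n)
log₄ (suc (suc N)) _ with log₄ (suc N) (s≤s z≤n)
... | k , le , lt with m≤n⇒m<n∨m≡n lt
...   | inj₁ lt′ = k , m≤n⇒m≤1+n le , lt′
...   | inj₂ eq  = suc k , ≤-reflexive (sym eq) , subst (_< 4 ^ suc (suc k)) (sym eq) (^-monoʳ-< 4 (s≤s (s≤s z≤n)) (n<1+n (suc k)))

2^n*2^n≡4^n : ∀ n → 2 ^ n * 2 ^ n ≡ 4 ^ n
2^n*2^n≡4^n zero    = refl
2^n*2^n≡4^n (suc n) = trans (lemma (2 ^ n)) (cong (4 *_) (2^n*2^n≡4^n n))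
  where
  lemma : ∀ x → 2 * x * (2 * x) ≡ 4 * (x * x)
  lemma = solve-∀

-- Kept abstract, since the type checker would unfold the powers of two.
abstract
  exponent : ℕ
  exponent = 7

  exponent≡ : exponent ≡ 7
  exponent≡ = refl

-- For 4 ^ k ≤ N < 4 ^ suc k and Z = c 2 ^ k, the interval of `prime-between` starts at 4 Z² = 4 c²
-- 4 ^ k, which is above N, and ends at 64 c² 4 ^ k, which is at most 64 c² N. The factor c only
-- serves to make `j * j ≤ Z` true from k = 0 on.
weak-bertrand : ∃ λ C → ∀ N → 1 ≤ N → ∃ λ p → Prime p × N < p × p ≤ C * N
weak-bertrand = 64 * (c * c) , λ N N≥1 → search N (log₄ N N≥1)
  where
  open ≤-Reasoning
  c : ℕ
  c = 2 ^ exponent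
  100≤c : 100 ≤ c
  100≤c = subst (λ z → 100 ≤ 2 ^ z) (sym exponent≡) (≤ᵇ⇒≤ 100 128 _)
  module _ (k : ℕ) where
    Z j a : ℕ
    Z = c * 2 ^ k
    j = 3 + (exponent + k)
    a = 2 + ((exponent + k) + (exponent + k))
    Z≥1 : 1 ≤ Z
    Z≥1 = *-mono-≤ {1} (≤-trans (s≤s z≤n) 100≤c) (m^n>0 2 k)
    2^≡ : 2 ^ (exponent + k) ≡ Z
    2^≡ = ^-distribˡ-+-* 2 exponent k
    2^j≡ : 2 ^ j ≡ 8 * Z
    2^j≡ = trans (^-distribˡ-+-* 2 3 (exponent + k)) (cong (8 *_) 2^≡)
    2^a≡ : 2 ^ a ≡ 4 * (Z * Z)
    2^a≡ = trans (^-distribˡ-+-* 2 2 ((exponent + k) + (exponent + k)))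
             (cong (4 *_) (trans (^-distribˡ-+-* 2 (exponent + k) (exponent + k)) (cong₂ _*_ 2^≡ 2^≡)))
    j² : j * j ≤ Z
    j² = subst (λ z → (3 + (z + k)) * (3 + (z + k)) ≤ Z) (sym exponent≡) (square≤2^ c 100≤c k)
    square : Z * Z ≡ c * c * 4 ^ k
    square = trans (lemma c (2 ^ k)) (cong (c * c *_) (2^n*2^n≡4^n k))
      where
      lemma : ∀ c x → c * x * (c * x) ≡ c * c * (x * x)
      lemma = solve-∀
    conclude : ∀ N → 4 ^ k ≤ N → N < 4 ^ suc k → (∃ λ p → Prime p × 4 * (Z * Z) < p × p ≤ 64 * (Z * Z)) →
      ∃ λ p → Prime p × N < p × p ≤ 64 * (c * c) * N
    conclude N le lt (p , pp , lo , hi) = p , pp , N<p , p≤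
      where
      c≥1 : 1 ≤ c
      c≥1 = ≤-trans (s≤s z≤n) 100≤c
      N<p : N < p
      N<p = begin-strict
        N                     <⟨ lt ⟩
        4 * 4 ^ k             ≤⟨ *-monoʳ-≤ 4 (m≤n*m (4 ^ k) (c * c) {{>-nonZero (*-mono-≤ c≥1 c≥1)}}) ⟩
        4 * (c * c * 4 ^ k)   ≡⟨ cong (4 *_) (sym square) ⟩
        4 * (Z * Z)           <⟨ lo ⟩
        p ∎
      p≤ : p ≤ 64 * (c * c) * N
      p≤ = begin
        p                     ≤⟨ hi ⟩
        64 * (Z * Z)          ≡⟨ cong (64 *_) square ⟩
        64 * (c * c * 4 ^ k)  ≡⟨ sym (*-assoc 64 (c * c) (4 ^ k)) ⟩
        64 * (c * c) * 4 ^ k  ≤⟨ *-monoʳ-≤ (64 * (c * c)) le ⟩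
        64 * (c * c) * N ∎
  search : ∀ N → (∃ λ k → 4 ^ k ≤ N × N < 4 ^ suc k) → ∃ λ p → Prime p × N < p × p ≤ 64 * (c * c) * N
  search N (k , le , lt) = conclude k N le lt (prime-between (j k) (a k) (Z k) (Z≥1 k) (2^j≡ k) (2^a≡ k) (j² k))

private
  -- Makes the choice of a prime total in N, so that fields can be named before their argument is
  -- known to be positive. The search starts at N + 1 ≤ 2 N, whence the doubled constant.
  from-zero : (∃ λ C → ∀ N → 1 ≤ N → ∃ λ p → Prime p × N < p × p ≤ C * N) →
    ∃ λ C → ∀ N → ∃ λ p → Prime p × N < p × (1 ≤ N → p ≤ C * N)
  from-zero (C , primes) = C + C , λ N → widen N (primes (suc N) (s≤s z≤n))
    where
    lemma : ∀ C N → C * (N + N) ≡ (C + C) * N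
    lemma = solve-∀
    widen : ∀ N → (∃ λ p → Prime p × suc N < p × p ≤ C * suc N) → ∃ λ p → Prime p × N < p × (1 ≤ N → p ≤ (C + C) * N)
    widen N (p , pp , lt , le) = p , pp , <-trans (n<1+n N) lt , λ N≥1 →
      ≤-trans le (≤-trans (*-monoʳ-≤ C (+-monoˡ-≤ N N≥1)) (≤-reflexive (lemma C N)))

abstract
  next-prime : ∃ λ C → ∀ N → ∃ λ p → Prime p × N < p × (1 ≤ N → p ≤ C * N)
  next-prime = from-zero weak-bertrand

-- Counting, and curves over prime fields

𝟙 : Bool → ℕ
𝟙 b = if b then 1 else 0

𝟙≤1 : ∀ b → 𝟙 b ≤ 1
𝟙≤1 true  = ≤-refl
𝟙≤1 false = z≤n

∑ : ∀ {A : Set} → List A → (A → ℕ) → ℕ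
∑ xs f = sum (map f xs)

sumTo : ℕ → (ℕ → ℕ) → ℕ
sumTo zero    f = 0
sumTo (suc n) f = sumTo n f + f n

module _ {A : Set} where

  ∑-mono : ∀ (xs : List A) {f g} → (∀ x → x ∈ xs → f x ≤ g x) → ∑ xs f ≤ ∑ xs g
  ∑-mono []       h = z≤n
  ∑-mono (x ∷ xs) h = +-mono-≤ (h x (here refl)) (∑-mono xs (λ y → h y ∘ there))

  ∑-+ : ∀ (xs : List A) f g → ∑ xs (λ x → f x + g x) ≡ ∑ xs f + ∑ xs g
  ∑-+ []       f g = refl
  ∑-+ (x ∷ xs) f g = trans (cong (λ z → f x + g x + z) (∑-+ xs f g)) (lemma (f x) (g x) (∑ xs f) (∑ xs g))
    where
    lemma : ∀ a b c d → a + b + (c + d) ≡ a + c + (b + d)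
    lemma = solve-∀

  ∑-*ʳ : ∀ (xs : List A) f k → ∑ xs (λ x → f x * k) ≡ ∑ xs f * k
  ∑-*ʳ []       f k = refl
  ∑-*ʳ (x ∷ xs) f k = trans (cong (λ z → f x * k + z) (∑-*ʳ xs f k)) (sym (*-distribʳ-+ k (f x) (∑ xs f)))

  ∑≤ : ∀ (xs : List A) f k → (∀ x → x ∈ xs → f x ≤ k) → ∑ xs f ≤ length xs * k
  ∑≤ []       f k h = z≤n
  ∑≤ (x ∷ xs) f k h = +-mono-≤ (h x (here refl)) (∑≤ xs f k (λ y → h y ∘ there))

  ∑≡0⇒≡0 : ∀ (xs : List A) f {x} → x ∈ xs → ∑ xs f ≤ 0 → f x ≡ 0
  ∑≡0⇒≡0 (x ∷ xs) f (here refl) le = n≤0⇒n≡0 (≤-trans (m≤m+n _ _) le)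
  ∑≡0⇒≡0 (x ∷ xs) f (there i)   le = ∑≡0⇒≡0 xs f i (≤-trans (m≤n+m _ _) le)

  sumTo-∑ : ∀ n (xs : List A) (f : ℕ → A → ℕ) → sumTo n (λ x → ∑ xs (f x)) ≡ ∑ xs (λ u → sumTo n (λ x → f x u))
  sumTo-∑ zero    xs f = sym (n≤0⇒n≡0 (≤-trans (∑≤ xs (λ _ → 0) 0 (λ _ _ → z≤n)) (≤-reflexive (*-zeroʳ (length xs)))))
  sumTo-∑ (suc n) xs f = trans (cong (λ z → z + ∑ xs (f n)) (sumTo-∑ n xs f)) (sym (∑-+ xs (λ u → sumTo n (λ x → f x u)) (f n)))

sumTo-mono : ∀ n {f g} → (∀ x → x < n → f x ≤ g x) → sumTo n f ≤ sumTo n g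
sumTo-mono zero    h = z≤n
sumTo-mono (suc n) h = +-mono-≤ (sumTo-mono n (λ x lt → h x (m<n⇒m<1+n lt))) (h n ≤-refl)

sumTo-+ : ∀ n f g → sumTo n (λ x → f x + g x) ≡ sumTo n f + sumTo n g
sumTo-+ zero    f g = refl
sumTo-+ (suc n) f g = trans (cong (λ z → z + (f n + g n)) (sumTo-+ n f g)) (lemma (sumTo n f) (sumTo n g) (f n) (g n))
  where
  lemma : ∀ a b c d → a + b + (c + d) ≡ a + c + (b + d)
  lemma = solve-∀

sumTo-0 : ∀ n {f} → (∀ x → x < n → f x ≡ 0) → sumTo n f ≡ 0
sumTo-0 zero    h = refl
sumTo-0 (suc n) h = cong₂ _+_ (sumTo-0 n (λ x lt → h x (m<n⇒m<1+n lt))) (h n ≤-refl)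

true≢false : true ≢ false
true≢false ()

T⇒≡ : ∀ {b} → T b → b ≡ true
T⇒≡ {true} _ = refl

≡⇒T : ∀ {b} → b ≡ true → T b
≡⇒T refl = tt

≡ᵇ-true : ∀ {m n} → m ≡ n → (m ≡ᵇ n) ≡ true
≡ᵇ-true {m} {n} e = T⇒≡ (≡⇒≡ᵇ m n e)

≡ᵇ-true⁻ : ∀ {m n} → (m ≡ᵇ n) ≡ true → m ≡ n
≡ᵇ-true⁻ {m} {n} e = ≡ᵇ⇒≡ m n (≡⇒T e)

≡ᵇ-false : ∀ {m n} → m ≢ n → (m ≡ᵇ n) ≡ false
≡ᵇ-false {m} {n} ne with m ≡ᵇ n in e
... | true  = contradiction (≡ᵇ-true⁻ e) ne
... | false = refl

-- The result is 0 if there is no x < n with g x ≤ b.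
pick : ℕ → ℕ → (ℕ → ℕ) → ℕ
pick zero    b g = 0
pick (suc n) b g = if g n ≤ᵇ b then n else pick n b g

-- Pigeonhole: if g exceeded b everywhere below n, its sum would be at least n (b + 1). All free
-- choices of the algorithm, of points and of translations, rest on this.
pick-spec : ∀ n b g → sumTo n g < n * suc b → pick n b g < n × g (pick n b g) ≤ b
pick-spec (suc n) b g lt with g n ≤ᵇ b in e
... | true  = ≤-refl , ≤ᵇ⇒≤ (g n) b (≡⇒T e)
... | false with pick-spec n b g (+-cancelʳ-< (suc b) _ _ (≤-<-trans (+-monoʳ-≤ (sumTo n g) gn>b) (<-≤-trans lt (≤-reflexive (+-comm (suc b) (n * suc b))))))
  where
  gn>b : suc b ≤ g n
  gn>b = ≰⇒> λ le → true≢false (trans (sym (T⇒≡ (≤⇒≤ᵇ le))) e)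
...   | lt′ , le = m<n⇒m<1+n lt′ , le

hits : (ℕ → Bool) → ℕ → List ℕ
hits P zero    = []
hits P (suc n) = if P n then n ∷ hits P n else hits P n

hits-length : ∀ P n → length (hits P n) ≡ sumTo n (𝟙 ∘ P)
hits-length P zero    = refl
hits-length P (suc n) with P n
... | true  = trans (cong suc (hits-length P n)) (+-comm 1 _)
... | false = trans (hits-length P n) (sym (+-identityʳ _))

hits-< : ∀ P n → All (_< n) (hits P n)
hits-< P zero    = []
hits-< P (suc n) with P n
... | true  = ≤-refl ∷ All.map m<n⇒m<1+n (hits-< P n)
... | false = All.map m<n⇒m<1+n (hits-< P n)

hits-true : ∀ P n → All (λ x → P x ≡ true) (hits P n)
hits-true P zero    = []
hits-true P (suc n) with P n in e
... | true  = e ∷ hits-true P n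
... | false = hits-true P n

hits-unique : ∀ P n → Unique (hits P n)
hits-unique P zero    = []
hits-unique P (suc n) with P n
... | true  = All.map (λ lt eq → <⇒≢ lt (sym eq)) (hits-< P n) ∷ hits-unique P n
... | false = hits-unique P n

evaluate : List ℤ → ℤ → ℤ
evaluate []       x = + 0
evaluate (c ∷ cs) x = c ℤ.+ x ℤ.* evaluate cs x

syntheticQuotient : ℤ → List ℤ → List ℤ
syntheticQuotient a []             = []
syntheticQuotient a (c ∷ [])       = []
syntheticQuotient a (c ∷ cs@(_ ∷ _)) = evaluate cs a ∷ syntheticQuotient a cs

evaluate-syntheticQuotient : ∀ cs x a → evaluate cs x ≡ evaluate cs a ℤ.+ (x ℤ.- a) ℤ.* evaluate (syntheticQuotient a cs) x
evaluate-syntheticQuotient []             x a = lemma x a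
  where
  lemma : ∀ x a → + 0 ≡ + 0 ℤ.+ (x ℤ.- a) ℤ.* + 0
  lemma = ℤ.solve-∀
evaluate-syntheticQuotient (c ∷ [])       x a = lemma c x a
  where
  lemma : ∀ c x a → c ℤ.+ x ℤ.* + 0 ≡ c ℤ.+ a ℤ.* + 0 ℤ.+ (x ℤ.- a) ℤ.* + 0
  lemma = ℤ.solve-∀
evaluate-syntheticQuotient (c ∷ cs@(_ ∷ _)) x a =
  trans (cong (λ z → c ℤ.+ x ℤ.* z) (evaluate-syntheticQuotient cs x a)) (lemma c x a (evaluate cs a) (evaluate (syntheticQuotient a cs) x))
  where
  lemma : ∀ c x a e g → c ℤ.+ x ℤ.* (e ℤ.+ (x ℤ.- a) ℤ.* g) ≡ c ℤ.+ a ℤ.* e ℤ.+ (x ℤ.- a) ℤ.* (e ℤ.+ x ℤ.* g)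
  lemma = ℤ.solve-∀

length-syntheticQuotient : ∀ a c cs → length (syntheticQuotient a (c ∷ cs)) ≡ length cs
length-syntheticQuotient a c []       = refl
length-syntheticQuotient a c (d ∷ cs) = cong suc (length-syntheticQuotient a d cs)

-- The quotient consists of the Horner values of the proper tails at a, and Horner's recurrence
-- expresses each coefficient by two consecutive values.
∣syntheticQuotient⇒∣ : ∀ {k} a cs → k ℤ.∣ evaluate cs a → All (k ℤ.∣_) (syntheticQuotient a cs) → All (k ℤ.∣_) cs
∣syntheticQuotient⇒∣ a []       d all = []
∣syntheticQuotient⇒∣ {k} a (c ∷ []) d all = subst (k ℤ.∣_) (lemma c a) d ∷ []
  where
  lemma : ∀ c a → c ℤ.+ a ℤ.* + 0 ≡ c
  lemma = ℤ.solve-∀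
∣syntheticQuotient⇒∣ a (c ∷ cs@(_ ∷ _)) d (e ∷ all) = ℤ.∣m+n∣n⇒∣m d (ℤ.∣n⇒∣m*n a e) ∷ ∣syntheticQuotient⇒∣ a cs e all

euclidℤ : ∀ {p} → Prime p → ∀ x y → + p ℤ.∣ x ℤ.* y → + p ℤ.∣ x ⊎ + p ℤ.∣ y
euclidℤ {p} pp x y d with euclidsLemma ℤ.∣ x ∣ ℤ.∣ y ∣ pp (subst (λ z → p ∣ z) (ℤ.abs-* x y) (ℤ.∣⇒∣ᵤ d))
... | inj₁ e = inj₁ (ℤ.∣ᵤ⇒∣ e)
... | inj₂ e = inj₂ (ℤ.∣ᵤ⇒∣ e)

∣difference⇒≡ : ∀ {p x y} → x < p → y < p → + p ℤ.∣ + x ℤ.- + y → x ≡ y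
∣difference⇒≡ {p} {x} {y} x<p y<p d with ℤ.∣⇒∣ᵤ d
... | d′ rewrite ℤ.m-n≡m⊖n x y with <-cmp x y
... | tri≈ _ eq _ = eq
... | tri< lt _ _ rewrite ℤ.∣⊖∣-≤ (<⇒≤ lt) =
  contradiction (∣⇒≤ {{>-nonZero (m<n⇒0<n∸m lt)}} d′) (<⇒≱ (≤-<-trans (m∸n≤m y x) y<p))
... | tri> _ _ lt rewrite ℤ.⊖-≥ (<⇒≤ lt) =
  contradiction (∣⇒≤ {{>-nonZero (m<n⇒0<n∸m lt)}} d′) (<⇒≱ (≤-<-trans (m∸n≤m x y) x<p))

-- Lagrange's bound on the roots modulo p, kept over ℤ so that no residue field has to be built.
-- Splitting off the root a leaves the other roots to the quotient, since p is prime and does not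
-- divide x - a.
many-roots⇒∣ : ∀ {p} → Prime p → ∀ cs xs → Unique xs → All (_< p) xs → All (λ x → + p ℤ.∣ evaluate cs (+ x)) xs →
  length cs ≤ length xs → All (+ p ℤ.∣_) cs
many-roots⇒∣ pp []       xs       _         _          _        _        = []
many-roots⇒∣ {p} pp (c ∷ cs) (a ∷ xs) (a∉ ∷ uniq) (a<p ∷ <p) (d ∷ ds) (s≤s le) =
  ∣syntheticQuotient⇒∣ (+ a) (c ∷ cs) d (many-roots⇒∣ pp (syntheticQuotient (+ a) (c ∷ cs)) xs uniq <p (roots xs a∉ <p ds)
    (≤-trans (≤-reflexive (length-syntheticQuotient (+ a) c cs)) le))
  where
  roots : ∀ xs → All (a ≢_) xs → All (_< p) xs → All (λ x → + p ℤ.∣ evaluate (c ∷ cs) (+ x)) xs →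
    All (λ x → + p ℤ.∣ evaluate (syntheticQuotient (+ a) (c ∷ cs)) (+ x)) xs
  roots []       []         []         []       = []
  roots (x ∷ xs) (a≢x ∷ a∉) (x<p ∷ <p) (e ∷ es) with euclidℤ pp (+ x ℤ.- + a) _
      (ℤ.∣m+n∣m⇒∣n (subst (+ p ℤ.∣_) (evaluate-syntheticQuotient (c ∷ cs) (+ x) (+ a)) e) d)
  ... | inj₁ f = contradiction (sym (∣difference⇒≡ x<p a<p f)) a≢x
  ... | inj₂ f = f ∷ roots xs a∉ <p es

-- Only the coefficients beyond the constant one have to be nonzero modulo p, so the bound is
-- insensitive to translations of curves.
few-roots : ∀ {p} → Prime p → ∀ c cs → ¬ All (+ p ℤ.∣_) cs → ∀ P → (∀ x → P x ≡ true → + p ℤ.∣ evaluate (c ∷ cs) (+ x)) →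
  sumTo p (𝟙 ∘ P) ≤ length cs
few-roots {p} pp c cs nonzero P root = ≮⇒≥ λ lt →
  nonzero (All.tail (many-roots⇒∣ pp (c ∷ cs) (hits P p) (hits-unique P p) (hits-< P p)
    (All.map (λ {x} → root x) (hits-true P p)) (≤-trans lt (≤-reflexive (sym (hits-length P p))))))

module _ (q : ℕ) .{{_ : NonZero q}} where

  digitPoly : ℕ → ℕ → ℕ → ℕ
  digitPoly zero    ψ x = 0
  digitPoly (suc D) ψ x = ψ % q + x * digitPoly D (ψ / q) x

  -- The factor x clears the constant term of the polynomial with the digits of ψ, which makes room
  -- for the translation c: no translate can turn the curve of one colour into that of another.
  curve : ℕ → ℕ → ℕ → ℕ → ℕ
  curve D ψ c x = (x * digitPoly D ψ x + c) % q

  digitDifferences : ℕ → ℕ → ℕ → List ℤ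
  digitDifferences zero    ψ φ = []
  digitDifferences (suc D) ψ φ = (+ (ψ % q) ℤ.- + (φ % q)) ∷ digitDifferences D (ψ / q) (φ / q)

  length-digitDifferences : ∀ D ψ φ → length (digitDifferences D ψ φ) ≡ D
  length-digitDifferences zero    ψ φ = refl
  length-digitDifferences (suc D) ψ φ = cong suc (length-digitDifferences D (ψ / q) (φ / q))

  evaluate-digitDifferences : ∀ D ψ φ x → evaluate (digitDifferences D ψ φ) (+ x) ≡ + digitPoly D ψ x ℤ.- + digitPoly D φ x
  evaluate-digitDifferences zero    ψ φ x = refl
  evaluate-digitDifferences (suc D) ψ φ x =
    trans (cong (λ z → + (ψ % q) ℤ.- + (φ % q) ℤ.+ + x ℤ.* z) (evaluate-digitDifferences D (ψ / q) (φ / q) x))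
      (trans (lemma (+ (ψ % q)) (+ (φ % q)) (+ x) (+ digitPoly D (ψ / q) x) (+ digitPoly D (φ / q) x))
        (sym (cong₂ ℤ._-_ (expand (ψ % q) (digitPoly D (ψ / q) x)) (expand (φ % q) (digitPoly D (φ / q) x)))))
    where
    expand : ∀ a u → + (a + x * u) ≡ + a ℤ.+ + x ℤ.* + u
    expand a u = trans (ℤ.pos-+ a (x * u)) (cong (ℤ._+_ (+ a)) (ℤ.pos-* x u))
    lemma : ∀ a b x u v → a ℤ.- b ℤ.+ x ℤ.* (u ℤ.- v) ≡ a ℤ.+ x ℤ.* u ℤ.- (b ℤ.+ x ℤ.* v)
    lemma = ℤ.solve-∀

  digitDifferences-injective : ∀ D ψ φ → ψ < q ^ D → φ < q ^ D → All (+ q ℤ.∣_) (digitDifferences D ψ φ) → ψ ≡ φ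
  digitDifferences-injective zero    zero zero _ _ [] = refl
  digitDifferences-injective zero    (suc ψ) _ (s≤s ()) _ []
  digitDifferences-injective zero    zero (suc φ) _ (s≤s ()) []
  digitDifferences-injective (suc D) ψ φ ψ< φ< (d ∷ ds) =
    trans (m≡m%n+[m/n]*n ψ q) (trans (cong₂ (λ a b → a + b * q) (∣difference⇒≡ (m%n<n ψ q) (m%n<n φ q) d)
      (digitDifferences-injective D (ψ / q) (φ / q) (shrink ψ ψ<) (shrink φ φ<) ds)) (sym (m≡m%n+[m/n]*n φ q)))
    where
    shrink : ∀ χ → χ < q ^ suc D → χ / q < q ^ D
    shrink χ χ< = m<n*o⇒m/o<n (<-≤-trans χ< (≤-reflexive (*-comm q (q ^ D))))

  %≡⇒∣ : ∀ m n → m % q ≡ n % q → + q ℤ.∣ + m ℤ.- + n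
  %≡⇒∣ m n eq = ℤ.divides (+ (m / q) ℤ.- + (n / q)) (trans (cong₂ ℤ._-_ (split m) (split n))
      (trans (cong (λ z → + z ℤ.+ + (m / q) ℤ.* + q ℤ.- (+ (n % q) ℤ.+ + (n / q) ℤ.* + q)) eq) (lemma (+ (n % q)) (+ (m / q)) (+ (n / q)) (+ q))))
    where
    split : ∀ m → + m ≡ + (m % q) ℤ.+ + (m / q) ℤ.* + q
    split m = trans (cong +_ (m≡m%n+[m/n]*n m q)) (trans (ℤ.pos-+ (m % q) (m / q * q)) (cong (ℤ._+_ (+ (m % q))) (ℤ.pos-* (m / q) q)))
    lemma : ∀ r a b q → r ℤ.+ a ℤ.* q ℤ.- (r ℤ.+ b ℤ.* q) ≡ (a ℤ.- b) ℤ.* q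
    lemma = ℤ.solve-∀

  curves-meet : Prime q → ∀ D ψ φ c d → ψ < q ^ D → φ < q ^ D → ψ ≢ φ →
    sumTo q (λ x → 𝟙 (curve D ψ c x ≡ᵇ curve D φ d x)) ≤ D
  curves-meet pq D ψ φ c d ψ< φ< ψ≢φ = ≤-trans
    (few-roots pq (+ c ℤ.- + d) (digitDifferences D ψ φ) (ψ≢φ ∘ digitDifferences-injective D ψ φ ψ< φ<) _ root)
    (≤-reflexive (length-digitDifferences D ψ φ))
    where
    root : ∀ x → (curve D ψ c x ≡ᵇ curve D φ d x) ≡ true → + q ℤ.∣ evaluate ((+ c ℤ.- + d) ∷ digitDifferences D ψ φ) (+ x)
    root x e = subst (+ q ℤ.∣_) eq (%≡⇒∣ _ _ (≡ᵇ-true⁻ e))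
      where
      u v : ℕ
      u = digitPoly D ψ x
      v = digitPoly D φ x
      lemma : ∀ x u v c d → x ℤ.* u ℤ.+ c ℤ.- (x ℤ.* v ℤ.+ d) ≡ c ℤ.- d ℤ.+ x ℤ.* (u ℤ.- v)
      lemma = ℤ.solve-∀
      expand : ∀ u c → + (x * u + c) ≡ + x ℤ.* + u ℤ.+ + c
      expand u c = trans (ℤ.pos-+ (x * u) c) (cong (ℤ._+ + c) (ℤ.pos-* x u))
      eq : + (x * u + c) ℤ.- + (x * v + d) ≡ evaluate ((+ c ℤ.- + d) ∷ digitDifferences D ψ φ) (+ x)
      eq = trans (cong₂ ℤ._-_ (expand u c) (expand v d)) (trans (lemma (+ x) (+ u) (+ v) (+ c) (+ d))
             (cong (λ z → + c ℤ.- + d ℤ.+ + x ℤ.* z) (sym (evaluate-digitDifferences D ψ φ x))))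

  digitPoly-0 : ∀ D x → digitPoly D 0 x ≡ 0
  digitPoly-0 zero    x = refl
  digitPoly-0 (suc D) x = cong₂ _+_ (m<n⇒m%n≡m {n = q} (>-nonZero⁻¹ q))
    (trans (cong (λ z → x * digitPoly D z x) (0/n≡0 q)) (trans (cong (x *_) (digitPoly-0 D x)) (*-zeroʳ x)))

  -- A constant y below q is a translate of the curve of colour 0, from which ψ differs. Other
  -- values y, such as the mark q of an unassigned vertex, are never met.
  curve-meets-constant : Prime q → ∀ D ψ c y → 1 ≤ ψ → ψ < q ^ D → sumTo q (λ x → 𝟙 (curve D ψ c x ≡ᵇ y)) ≤ D
  curve-meets-constant pq D ψ c y ψ≥1 ψ< with y <? q
  ... | yes y<q = ≤-trans (sumTo-mono q (λ x _ → ≤-reflexive (cong (λ z → 𝟙 (curve D ψ c x ≡ᵇ z)) (sym (constant x)))))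
                          (curves-meet pq D ψ 0 c y ψ< (m^n>0 q D) (λ ψ≡0 → <⇒≢ ψ≥1 (sym ψ≡0)))
    where
    constant : ∀ x → curve D 0 y x ≡ y
    constant x rewrite digitPoly-0 D x | *-zeroʳ x = m<n⇒m%n≡m y<q
  ... | no y≮q = ≤-trans (≤-reflexive (sumTo-0 q λ x _ → cong 𝟙 (≡ᵇ-false λ e → y≮q (subst (_< q) e (m%n<n _ q))))) z≤n

  -- The condition is linear in c with leading coefficient 1, so a point lies on at most one
  -- translate, whatever the degree in x.
  shifts-meet-constant : Prime q → ∀ D ψ x y → sumTo q (λ c → 𝟙 (curve D ψ c x ≡ᵇ (y % q))) ≤ 1
  shifts-meet-constant pq D ψ x y = few-roots pq (+ u ℤ.- + y) (+ 1 ∷ []) nonzero _ root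
    where
    u : ℕ
    u = x * digitPoly D ψ x
    nonzero : ¬ All (+ q ℤ.∣_) (+ 1 ∷ [])
    nonzero (d ∷ []) = contradiction (∣⇒≤ (ℤ.∣⇒∣ᵤ d)) (<⇒≱ (nonTrivial⇒n>1 q {{prime⇒nonTrivial pq}}))
    root : ∀ c → (curve D ψ c x ≡ᵇ (y % q)) ≡ true → + q ℤ.∣ evaluate ((+ u ℤ.- + y) ∷ + 1 ∷ []) (+ c)
    root c e = subst (+ q ℤ.∣_) (trans (cong (ℤ._- + y) (ℤ.pos-+ u c)) (lemma (+ u) (+ c) (+ y))) (%≡⇒∣ _ _ (≡ᵇ-true⁻ e))
      where
      lemma : ∀ u c y → u ℤ.+ c ℤ.- y ≡ u ℤ.- y ℤ.+ c ℤ.* (+ 1 ℤ.+ c ℤ.* + 0)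
      lemma = ℤ.solve-∀

-- Broadcast programs

-- One record for all phases gives all messages the same format. `hue` is the colour, `mark` the
-- class and later the status in the elections, `time` the round of joining the class, `shift` the
-- translation c.
record Reg : Set where
  constructor reg
  field
    hue mark time shift : ℕ
open Reg public

Step : Set
Step = Reg → List Reg → Reg

Below : ℕ → Reg → Set
Below N R = hue R < N × mark R < N × time R < N × shift R < N

module _ (N : ℕ) .{{_ : NonZero N}} where

  encode : Reg → ℕ
  encode (reg a b c d) = a + (b + (c + d * N) * N) * N

  decode : ℕ → Reg
  decode m = reg (m % N) (m / N % N) (m / N / N % N) (m / N / N / N)

  low : ∀ a m → a < N → (a + m * N) % N ≡ a
  low a m a<N = trans ([m+kn]%n≡m%n a m N) (m<n⇒m%n≡m a<N)

  high : ∀ a m → a < N → (a + m * N) / N ≡ m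
  high a m a<N = trans (+-distrib-/-∣ʳ a (divides m refl)) (cong₂ _+_ (m<n⇒m/n≡0 a<N) (m*n/n≡m m N))

  digits-< : ∀ {a m} M → a < N → m < M → a + m * N < N * M
  digits-< {a} {m} M a< m< = begin-strict
    a + m * N <⟨ +-monoˡ-< (m * N) a< ⟩
    N + m * N ≤⟨ *-monoˡ-≤ N m< ⟩
    M * N     ≡⟨ *-comm M N ⟩
    N * M     ∎
    where open ≤-Reasoning

  decode-encode : ∀ R → Below N R → decode (encode R) ≡ R
  decode-encode (reg a b c d) (a< , b< , c< , d<)
    rewrite low a (b + (c + d * N) * N) a< | high a (b + (c + d * N) * N) a<
          | low b (c + d * N) b< | high b (c + d * N) b< | low c d c< | high c d c< = refl

  encode-< : ∀ R → Below N R → encode R < N * (N * (N * N))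
  encode-< (reg a b c d) (a< , b< , c< , d<) = digits-< _ a< (digits-< _ b< (digits-< _ c< d<))

capacity : ℕ → ℕ → ℕ
capacity B n = 2 ^ (B * (1 + ⌈log₂ n ⌉))

module _ (B n : ℕ) where
  instance
    capacity≢0 : NonZero (capacity B n)
    capacity≢0 = m^n≢0 2 (B * (1 + ⌈log₂ n ⌉))

module _ {n : ℕ} (ports : Fin n → List (Fin n)) where

  exec : Step → (Fin n → Reg) → Fin n → Reg
  exec f X v = f (X v) (map X (ports v))

  -- The bound N on the registers that are sent on the way to a configuration with P is what limits the bandwidth.
  Leads : ℕ → (Fin n → Reg) → List Step → ((Fin n → Reg) → Set) → Set
  Leads N X []       P = P X
  Leads N X (f ∷ fs) P = (∀ v → Below N (X v)) × Leads N (exec f X) fs P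

  leads-++ : ∀ {N X P Q} fs gs → Leads N X fs P → (∀ Y → P Y → Leads N Y gs Q) → Leads N X (fs ++ gs) Q
  leads-++ []       gs p       h = h _ p
  leads-++ (f ∷ fs) gs (b , l) h = b , leads-++ fs gs l h

  leads-⇒ : ∀ {N X P Q} fs → Leads N X fs P → (∀ Y → P Y → Q Y) → Leads N X fs Q
  leads-⇒ []       p       h = h _ p
  leads-⇒ (f ∷ fs) (b , l) h = b , leads-⇒ fs l h

loop : (ℕ → List Step) → ℕ → ℕ → List Step
loop body a zero    = []
loop body a (suc k) = body a ++ loop body (suc a) k

length-loop : ∀ body l → (∀ i → length (body i) ≡ l) → ∀ a k → length (loop body a k) ≡ k * l
length-loop body l h a zero    = refl
length-loop body l h a (suc k) = trans (length-++ (body a)) (cong₂ _+_ (h a) (length-loop body l h (suc a) k))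

leads-loop : ∀ {n} (ports : Fin n → List (Fin n)) {N} body (I : ℕ → (Fin n → Reg) → Set) q →
  (∀ i X → i < q → I i X → Leads ports N X (body i) (I (suc i))) →
  ∀ a k X → a + k ≡ q → I a X → Leads ports N X (loop body a k) (I q)
leads-loop ports body I q h a zero    X refl i = subst (λ z → I z X) (sym (+-identityʳ a)) i
leads-loop ports body I q h a (suc k) X refl i =
  leads-++ ports (body a) _ (h a X (m<m+n a (s≤s z≤n)) i) λ Y j → leads-loop ports body I q h (suc a) k Y (sym (+-suc a k)) j

-- The state carries the steps that remain, so the program depends on n and Δ alone and all vertices
-- stay in lockstep, and it carries n, which determines the radix of the messages.
simulate : ℕ → (ℕ → ℕ → List Step) → (ℕ → ℕ → ℕ → Reg) → (Reg → Bool) → CongestAlg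
simulate B program start accept = record
  { State  = ℕ × List Step × Reg
  ; init   = λ n Δ id _ → n , program n Δ , start n Δ id
  ; send   = λ { (n , _ , R) _ → encode (capacity B n) {{capacity≢0 B n}} R }
  ; recv   = λ { (n , [] , R) _ → n , [] , R
               ; (n , f ∷ fs , R) ms → n , fs , f R (map (λ m → decode (capacity B n) {{capacity≢0 B n}} (proj₂ m)) ms) }
  ; output = λ { (_ , _ , R) → accept R }
  ; rounds = λ n Δ → length (program n Δ)
  }

module _ (B : ℕ) (program : ℕ → ℕ → List Step) (start : ℕ → ℕ → ℕ → Reg) (accept : Reg → Bool)
         {n : ℕ} (G : Graph n) (ids : Fin n → ℕ) (ports : Fin n → List (Fin n)) where
  private
    A : CongestAlg
    A = simulate B program start accept
    Δ : ℕ
    Δ = maxDegree G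
    N : ℕ
    N = capacity B n
    instance
      N≢0 : NonZero N
      N≢0 = capacity≢0 B n
    X₀ : Fin n → Reg
    X₀ v = start n Δ (ids v)

  record Tracks (P : (Fin n → Reg) → Set) (t : ℕ) : Set where
    constructor tracks
    field
      rest    : List Step
      config  : Fin n → Reg
      elapsed : t + length rest ≡ length (program n Δ)
      agrees  : ∀ v → stateAt A G ids ports t v ≡ (n , rest , config v)
      leads   : Leads ports N config rest P

  track : ∀ {P} → Leads ports N X₀ (program n Δ) P → ∀ t → t ≤ length (program n Δ) → Tracks P t
  track l zero    _  = tracks (program n Δ) X₀ refl (λ _ → refl) l
  track l (suc t) lt with track l t (<⇒≤ lt)
  ... | tracks []       X el ag ld = contradiction (trans (sym (+-identityʳ t)) el) (<⇒≢ lt)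
  ... | tracks (f ∷ fs) X el ag (b , ld) = tracks fs (exec ports f X) (trans (sym (+-suc t (length fs))) el) agree ld
    where
    agree : ∀ v → stateAt A G ids ports (suc t) v ≡ (n , fs , exec ports f X v)
    agree v rewrite ag v = cong (λ z → n , fs , f (X v) z)
      (trans (sym (map-∘ (ports v))) (map-cong received (ports v)))
      where
      received : ∀ u → decode N (CongestAlg.send A (stateAt A G ids ports t u) (ids v)) ≡ X u
      received u rewrite ag u = decode-encode N (X u) (b u)

  simulate-bandwidth : ∀ {P} → Leads ports N X₀ (program n Δ) P → BandwidthOK A G ids ports (4 * B) (length (program n Δ))
  simulate-bandwidth l t lt v u _ with track l t (<⇒≤ lt)
  ... | tracks []       X el ag ld = contradiction (trans (sym (+-identityʳ t)) el) (<⇒≢ lt)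
  ... | tracks (f ∷ fs) X el ag (b , _) rewrite ag u = <-≤-trans (encode-< N (X u) (b u)) (≤-reflexive pow)
    where
    L : ℕ
    L = 1 + ⌈log₂ n ⌉
    -- Four fields below 2 ^ (B * L) each, hence bandwidth 4 * B.
    pow : N * (N * (N * N)) ≡ 2 ^ (4 * B * L)
    pow = trans (sym (cong (λ z → N * (N * (N * z))) (*-identityʳ N)))
            (trans (^-*-assoc 2 (B * L) 4) (cong (2 ^_) (trans (*-comm (B * L) 4) (sym (*-assoc 4 B L)))))

  simulate-output : ∀ {P} → Leads ports N X₀ (program n Δ) P →
    ∃ λ X → P X × (∀ v → finalOutput A G ids ports v ≡ accept (X v))
  simulate-output l with track l (length (program n Δ)) ≤-refl
  ... | tracks []       X el ag ld = X , ld , λ v → cong (CongestAlg.output A) (ag v)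
  ... | tracks (f ∷ fs) X el ag _  = contradiction (sym el) (<⇒≢ (m<m+n _ (s≤s z≤n)))

-- Each entry of `xs` is cut out of `ys` once it is counted; uniqueness keeps the rest of `xs`
-- inside what remains. With an indicator for f, it bounds the number of ports by the degree.
length≤∑ : ∀ {A : Set} (f : A → ℕ) xs ys → Unique xs → (∀ x → x ∈ xs → x ∈ ys) → (∀ x → x ∈ xs → 1 ≤ f x) → length xs ≤ ∑ ys f
length≤∑ f []       ys u sub pos = z≤n
length≤∑ f (x ∷ xs) ys (x∉ ∷ u) sub pos with ∈-∃++ (sub x (here refl))
... | as , bs , refl = begin
  1 + length xs                     ≤⟨ +-mono-≤ (pos x (here refl)) (length≤∑ f xs (as ++ bs) u sub′ (λ y → pos y ∘ there)) ⟩
  f x + ∑ (as ++ bs) f              ≡⟨ cong (λ z → f x + z) (split bs) ⟩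
  f x + (∑ as f + ∑ bs f)           ≡⟨ lemma (f x) (∑ as f) (∑ bs f) ⟩
  ∑ as f + ∑ (x ∷ bs) f             ≡⟨ sym (split (x ∷ bs)) ⟩
  ∑ (as ++ x ∷ bs) f                ∎
  where
  open ≤-Reasoning
  lemma : ∀ a b c → a + (b + c) ≡ b + (a + c)
  lemma = solve-∀
  split : ∀ cs → ∑ (as ++ cs) f ≡ ∑ as f + ∑ cs f
  split cs = trans (cong sum (map-++ f as cs)) (sum-++ (map f as) (map f cs))
  sub′ : ∀ y → y ∈ xs → y ∈ as ++ bs
  sub′ y i with ∈-++⁻ as (sub y (there i))
  ... | inj₁ j             = ∈-++⁺ˡ j
  ... | inj₂ (there j)     = ∈-++⁺ʳ as j
  ... | inj₂ (here refl)   = contradiction refl (All.lookup x∉ i)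

≤-foldr-⊔ : ∀ {A : Set} (f : A → ℕ) {x} xs → x ∈ xs → f x ≤ foldr _⊔_ 0 (map f xs)
≤-foldr-⊔ f (x ∷ xs) (here refl) = m≤m⊔n _ _
≤-foldr-⊔ f (x ∷ xs) (there i)   = ≤-trans (≤-foldr-⊔ f xs i) (m≤n⊔m _ _)

foldr-⊔-≤ : ∀ {A : Set} (f : A → ℕ) xs {k} → (∀ x → f x ≤ k) → foldr _⊔_ 0 (map f xs) ≤ k
foldr-⊔-≤ f []       h = z≤n
foldr-⊔-≤ f (x ∷ xs) h = ⊔-lub (h x) (foldr-⊔-≤ f xs h)

maxDegree≤ : ∀ {n} (G : Graph n) → maxDegree G ≤ n
maxDegree≤ {n} G = foldr-⊔-≤ (degree G) (allFin n) λ v → begin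
  degree G v                ≤⟨ ∑≤ (allFin n) _ 1 (λ u _ → 𝟙≤1 (adj G v u)) ⟩
  length (allFin n) * 1     ≡⟨ trans (*-identityʳ _) (length-tabulate {n = n} _) ⟩
  n ∎
  where open ≤-Reasoning

module _ {n : ℕ} (G : Graph n) (ports : Fin n → List (Fin n)) (numbering : IsPortNumbering G ports) where

  ∈ports⇒adj : ∀ {u v} → u ∈ ports v → adj G v u ≡ true
  ∈ports⇒adj {u} {v} = Equivalence.to (proj₂ (numbering v) u)

  adj⇒∈ports : ∀ {u v} → adj G v u ≡ true → u ∈ ports v
  adj⇒∈ports {u} {v} = Equivalence.from (proj₂ (numbering v) u)

  length-ports≤ : ∀ v → length (ports v) ≤ maxDegree G
  length-ports≤ v = ≤-trans
    (length≤∑ (λ u → 𝟙 (adj G v u)) (ports v) (allFin n) (proj₁ (numbering v)) (λ u _ → ∈-allFin u)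
      (λ u i → ≤-reflexive (cong 𝟙 (sym (∈ports⇒adj i)))))
    (≤-foldr-⊔ (degree G) (allFin n) (∈-allFin v))

-- Linial's colour reduction and the partition into classes of small outdegree

∑-map : ∀ {A B : Set} (g : A → B) xs (f : B → ℕ) → ∑ (map g xs) f ≡ ∑ xs (f ∘ g)
∑-map g xs f = cong sum (sym (map-∘ xs))

𝟙-∨∧ : ∀ a b c → 𝟙 (a ∨ (b ∧ c)) ≤ 𝟙 c + 𝟙 a
𝟙-∨∧ true  b     true  = s≤s z≤n
𝟙-∨∧ true  b     false = s≤s z≤n
𝟙-∨∧ false true  c     = ≤-reflexive (sym (+-identityʳ _))
𝟙-∨∧ false false c     = z≤n

𝟙-≤ : ∀ {a b} → (a ≡ true → b ≡ true) → 𝟙 a ≤ 𝟙 b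
𝟙-≤ {false}         h = z≤n
𝟙-≤ {true}  {true}  h = ≤-refl
𝟙-≤ {true}  {false} h with () ← h refl

∧-true : ∀ {a b} → a ≡ true → b ≡ true → a ∧ b ≡ true
∧-true refl refl = refl

∧-true⁻ : ∀ {a b} → a ∧ b ≡ true → a ≡ true × b ≡ true
∧-true⁻ {true} e = refl , e

∨-trueˡ : ∀ {a b} → a ≡ true → a ∨ b ≡ true
∨-trueˡ refl = refl

∨-trueʳ : ∀ a {b} → b ≡ true → a ∨ b ≡ true
∨-trueʳ true  e = refl
∨-trueʳ false e = e

¬true⇒false : ∀ {b} → b ≢ true → b ≡ false
¬true⇒false {true}  ne = contradiction refl ne
¬true⇒false {false} ne = refl

if-true : ∀ {A : Set} {b} {x y : A} → b ≡ true → (if b then x else y) ≡ x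
if-true refl = refl

if-false : ∀ {A : Set} {b} {x y : A} → b ≡ false → (if b then x else y) ≡ y
if-false refl = refl

-- The new colour encodes the point (x , f(x)) in base q. The successor keeps it positive, since
-- colour 0 is reserved for the constant curves.
linialStep : (d q : ℕ) .{{_ : NonZero q}} → Step
linialStep d q R Rs = record R { hue = suc (curve q d (hue R) 0 x + x * q) }
  where
  x : ℕ
  x = pick q 0 λ x → ∑ Rs λ S → 𝟙 (curve q d (hue R) 0 x ≡ᵇ curve q d (hue S) 0 x)

-- The mark q stands for a vertex that is not yet assigned to one of the classes 0, …, q - 1.
partitionStep : (D q β : ℕ) .{{_ : NonZero q}} → ℕ → Step
partitionStep D q β x R Rs = record R
  { mark = if joins then y else mark R
  ; time = if joins then x else time R
  }
  where
  y : ℕ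
  y = curve q D (hue R) 0 x
  joins : Bool
  joins = (mark R ≡ᵇ q) ∧ (∑ Rs (λ S → 𝟙 ((y ≡ᵇ mark S) ∨ ((mark S ≡ᵇ q) ∧ (y ≡ᵇ curve q D (hue S) 0 x)))) ≤ᵇ β)

partition : (D q β : ℕ) .{{_ : NonZero q}} → List Step
partition D q β = loop (λ x → partitionStep D q β x ∷ []) 0 q

-- Orients the edges inside a class towards the endpoint that joined no later; vertices that join
-- together point at each other.
out : Reg → Reg → Bool
out R S = (mark R ≡ᵇ mark S) ∧ (time S ≤ᵇ time R)

module Network {n : ℕ} (G : Graph n) (ports : Fin n → List (Fin n)) (numbering : IsPortNumbering G ports) (N : ℕ) where

  Δ : ℕ
  Δ = maxDegree G

  Proper : (Fin n → Reg) → Set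
  Proper X = ∀ v u → u ∈ ports v → hue (X v) ≢ hue (X u)

  record Coloured (k m : ℕ) (X : Fin n → Reg) : Set where
    field
      below   : ∀ v → Below N (X v)
      hue-pos : ∀ v → 1 ≤ hue (X v)
      hue-≤   : ∀ v → hue (X v) ≤ m
      proper  : Proper X
      mark-≡  : ∀ v → mark (X v) ≡ k

  module _ (d q : ℕ) (pq : Prime q) where
    private
      instance
        q≢0 : NonZero q
        q≢0 = prime⇒nonZero pq

    -- Each neighbour spoils at most d of the q points, and d Δ < q leaves one that lies on no curve
    -- of a neighbour. Neighbours with equal new colours would share such a point.
    linial-correct : ∀ {k m} → m < q ^ d → d * Δ < q → q * q < N → ∀ X → Coloured k m X →
      Coloured k (q * q) (exec ports (linialStep d q) X)
    linial-correct {k} {m} m< dΔ< qq<N X C = record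
      { below   = λ v → ≤-<-trans (hue′≤ v) qq<N , proj₂ (below v)
      ; hue-pos = λ v → s≤s z≤n
      ; hue-≤   = hue′≤
      ; proper  = λ v u i e → different v u i (suc-injective e)
      ; mark-≡  = mark-≡
      }
      where
      open Coloured C
      bad : Fin n → ℕ → Fin n → ℕ
      bad v x u = 𝟙 (curve q d (hue (X v)) 0 x ≡ᵇ curve q d (hue (X u)) 0 x)
      g : Fin n → ℕ → ℕ
      g v x = ∑ (map X (ports v)) λ S → 𝟙 (curve q d (hue (X v)) 0 x ≡ᵇ curve q d (hue S) 0 x)
      total : ∀ v → sumTo q (g v) < q * 1
      total v = begin-strict
        sumTo q (g v)                                    ≤⟨ sumTo-mono q (λ x _ → ≤-reflexive (∑-map X (ports v) _)) ⟩
        sumTo q (λ x → ∑ (ports v) (bad v x))            ≡⟨ sumTo-∑ q (ports v) (bad v) ⟩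
        ∑ (ports v) (λ u → sumTo q (λ x → bad v x u))    ≤⟨ ∑≤ (ports v) _ d (λ u i → curves-meet q pq d _ _ 0 0
                                                              (≤-<-trans (hue-≤ v) m<) (≤-<-trans (hue-≤ u) m<) (proper v u i)) ⟩
        length (ports v) * d                             ≤⟨ *-monoˡ-≤ d (length-ports≤ G ports numbering v) ⟩
        Δ * d                                            ≡⟨ *-comm Δ d ⟩
        d * Δ                                            <⟨ dΔ< ⟩
        q                                                ≡⟨ sym (*-identityʳ q) ⟩
        q * 1 ∎
        where open ≤-Reasoning
      x : Fin n → ℕ
      x v = pick q 0 (g v)
      y : Fin n → ℕ
      y v = curve q d (hue (X v)) 0 (x v)
      y<q : ∀ v → y v < q
      y<q v = m%n<n _ q
      hue′≤ : ∀ v → suc (y v + x v * q) ≤ q * q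
      hue′≤ v = digits-< q q (y<q v) (proj₁ (pick-spec q 0 (g v) (total v)))
      different : ∀ v u → u ∈ ports v → y v + x v * q ≢ y u + x u * q
      different v u i e = 1+n≢0 (trans (sym (cong 𝟙 (≡ᵇ-true meet))) none)
        where
        none : bad v (x v) u ≡ 0
        none = ∑≡0⇒≡0 (ports v) (bad v (x v)) i
          (≤-trans (≤-reflexive (sym (∑-map X (ports v) _))) (proj₂ (pick-spec q 0 (g v) (total v))))
        x≡ : x v ≡ x u
        x≡ = trans (sym (high q (y v) (x v) (y<q v))) (trans (cong (_/ q) e) (high q (y u) (x u) (y<q u)))
        meet : y v ≡ curve q d (hue (X u)) 0 (x v)
        meet = trans (sym (low q (y v) (x v) (y<q v))) (trans (cong (_% q) e) (trans (low q (y u) (x u) (y<q u))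
                 (cong (curve q d (hue (X u)) 0) (sym x≡))))

  record Partitioned (q β m : ℕ) (X : Fin n → Reg) : Set where
    field
      below   : ∀ v → Below N (X v)
      hue-pos : ∀ v → 1 ≤ hue (X v)
      hue-≤   : ∀ v → hue (X v) ≤ m
      proper  : Proper X
      mark-<  : ∀ v → mark (X v) < q
      out-≤   : ∀ v → ∑ (ports v) (λ u → 𝟙 (out (X v) (X u))) ≤ β

  module _ (D q β m : ℕ) (pq : Prime q) (m<q^D : m < q ^ D) (Δ-small : Δ * (D + D) < q * suc β) (q<N : q < N) where
    private
      instance
        q≢0 : NonZero q
        q≢0 = prime⇒nonZero pq

    private
      f : (Fin n → Reg) → ℕ → Fin n → ℕ
      f X x v = curve q D (hue (X v)) 0 x

      f<q : ∀ X x v → f X x v < q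
      f<q X x v = m%n<n _ q

      conflict : (Fin n → Reg) → ℕ → Fin n → Fin n → Bool
      conflict X x v u = (f X x v ≡ᵇ mark (X u)) ∨ ((mark (X u) ≡ᵇ q) ∧ (f X x v ≡ᵇ f X x u))

      -- The number of conflicts that u can cause for v at the times x < t.
      potential : (Fin n → Reg) → ℕ → Fin n → Fin n → ℕ
      potential X t v u = sumTo t λ x → 𝟙 (f X x v ≡ᵇ f X x u) + 𝟙 (f X x v ≡ᵇ mark (X u))

    -- `waiting` charges `suc β` conflicts to each failed round without recording a history: colours
    -- are fixed and a mark below q is final, so every past conflict still shows in the current
    -- configuration, as a meeting of two curves or of a curve with a mark.
    record Partitioning (t : ℕ) (X : Fin n → Reg) : Set where
      field
        below   : ∀ v → Below N (X v)
        hue-pos : ∀ v → 1 ≤ hue (X v)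
        hue-≤   : ∀ v → hue (X v) ≤ m
        proper  : Proper X
        waiting : ∀ v → mark (X v) ≡ q → t * suc β ≤ ∑ (ports v) (potential X t v)
        settled : ∀ v → mark (X v) ≢ q → mark (X v) < q × time (X v) < t × ∑ (ports v) (λ u → 𝟙 (out (X v) (X u))) ≤ β

    module _ (t : ℕ) (X : Fin n → Reg) (t<q : t < q) (I : Partitioning t X) where
      open Partitioning I
      private
        X′ : Fin n → Reg
        X′ = exec ports (partitionStep D q β t) X

        conflicts : Fin n → ℕ
        conflicts v = ∑ (ports v) (λ u → 𝟙 (conflict X t v u))

        data Outcome (v : Fin n) : Set where
          joins : mark (X v) ≡ q → conflicts v ≤ β → mark (X′ v) ≡ f X t v → time (X′ v) ≡ t → Outcome v
          waits : mark (X v) ≡ q → β < conflicts v → mark (X′ v) ≡ mark (X v) → time (X′ v) ≡ time (X v) → Outcome v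
          rests : mark (X v) ≢ q → mark (X′ v) ≡ mark (X v) → time (X′ v) ≡ time (X v) → Outcome v

        conflicts≡ : ∀ v → ∑ (map X (ports v)) (λ S → 𝟙 ((f X t v ≡ᵇ mark S) ∨ ((mark S ≡ᵇ q) ∧ (f X t v ≡ᵇ curve q D (hue S) 0 t)))) ≡ conflicts v
        conflicts≡ v = ∑-map X (ports v) _

        outcome : ∀ v → Outcome v
        outcome v with mark (X v) ≟ q | conflicts v ≤? β
        ... | yes e | yes le = joins e le (if-true joining) (if-true joining)
          where
          joining : (mark (X v) ≡ᵇ q) ∧ (∑ (map X (ports v)) _ ≤ᵇ β) ≡ true
          joining = ∧-true (≡ᵇ-true e) (T⇒≡ (≤⇒≤ᵇ (≤-trans (≤-reflexive (conflicts≡ v)) le)))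
        ... | yes e | no nle = waits e (≰⇒> nle) (if-false staying) (if-false staying)
          where
          staying : (mark (X v) ≡ᵇ q) ∧ (∑ (map X (ports v)) _ ≤ᵇ β) ≡ false
          staying = ¬true⇒false λ j → nle (≤-trans (≤-reflexive (sym (conflicts≡ v))) (≤ᵇ⇒≤ _ _ (≡⇒T (proj₂ (∧-true⁻ j)))))
        ... | no ne | _      = rests ne (if-false staying) (if-false staying)
          where
          staying : (mark (X v) ≡ᵇ q) ∧ (∑ (map X (ports v)) _ ≤ᵇ β) ≡ false
          staying = ¬true⇒false λ j → ne (≡ᵇ-true⁻ (proj₁ (∧-true⁻ j)))

        mark-grows : ∀ u {y} → y < q → 𝟙 (y ≡ᵇ mark (X u)) ≤ 𝟙 (y ≡ᵇ mark (X′ u))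
        mark-grows u {y} y<q with outcome u
        ... | joins e _ _ _   = 𝟙-≤ λ y≡ → contradiction (trans (≡ᵇ-true⁻ y≡) e) (<⇒≢ y<q)
        ... | waits _ _ e _   = ≤-reflexive (cong (λ z → 𝟙 (y ≡ᵇ z)) (sym e))
        ... | rests _ e _     = ≤-reflexive (cong (λ z → 𝟙 (y ≡ᵇ z)) (sym e))

        potential-grows : ∀ v u → 𝟙 (conflict X t v u) + potential X t v u ≤ potential X′ (suc t) v u
        potential-grows v u = ≤-trans (≤-reflexive (+-comm (𝟙 (conflict X t v u)) _)) (+-mono-≤
          (sumTo-mono t λ x _ → +-monoʳ-≤ (𝟙 (f X x v ≡ᵇ f X x u)) (mark-grows u (f<q X x v)))
          (≤-trans (𝟙-∨∧ (f X t v ≡ᵇ mark (X u)) (mark (X u) ≡ᵇ q) _) (+-monoʳ-≤ (𝟙 (f X t v ≡ᵇ f X t u)) (mark-grows u (f<q X t v)))))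

        -- Conflicts include undecided neighbours with the same value, as these may join in the same
        -- round. So the conflicts counted on joining cover all members of the class at that moment.
        joined-out : ∀ v u → mark (X v) ≡ q → mark (X′ v) ≡ f X t v → 𝟙 (out (X′ v) (X′ u)) ≤ 𝟙 (conflict X t v u)
        joined-out v u v-active v-mark = 𝟙-≤ λ o → conflicting (trans (sym v-mark) (≡ᵇ-true⁻ (proj₁ (∧-true⁻ o))))
          where
          conflicting : f X t v ≡ mark (X′ u) → conflict X t v u ≡ true
          conflicting e with outcome u
          ... | joins a _ b _   = ∨-trueʳ (f X t v ≡ᵇ mark (X u)) (∧-true (≡ᵇ-true a) (≡ᵇ-true (trans e b)))
          ... | waits _ _ b _   = ∨-trueˡ (≡ᵇ-true (trans e b))
          ... | rests _ b _     = ∨-trueˡ (≡ᵇ-true (trans e b))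

        -- Newcomers carry the time t, which is later than that of v, so v gains no outgoing edge.
        settled-out : ∀ v u → time (X v) < t → mark (X′ v) ≡ mark (X v) → time (X′ v) ≡ time (X v) →
          𝟙 (out (X′ v) (X′ u)) ≤ 𝟙 (out (X v) (X u))
        settled-out v u early v-mark v-time with outcome u
        ... | joins _ _ _ b = 𝟙-≤ λ o → contradiction (≤-trans (≤-reflexive (sym b)) (≤-trans (≤ᵇ⇒≤ _ _ (≡⇒T (proj₂ (∧-true⁻ o)))) (≤-reflexive v-time))) (<⇒≱ early)
        ... | waits _ _ a b rewrite v-mark | v-time | a | b = ≤-refl
        ... | rests _ a b   rewrite v-mark | v-time | a | b = ≤-refl

      partition-step : Partitioning (suc t) X′
      partition-step = record
        { below   = below′
        ; hue-pos = hue-pos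
        ; hue-≤   = hue-≤
        ; proper  = proper
        ; waiting = waiting′
        ; settled = settled′
        }
        where
        below′ : ∀ v → Below N (X′ v)
        below′ v with outcome v | below v
        ... | joins _ _ a b | h , m , t′ , s = h , subst (_< N) (sym a) (<-trans (f<q X t v) q<N) , subst (_< N) (sym b) (<-trans t<q q<N) , s
        ... | waits _ _ a b | h , m , t′ , s = h , subst (_< N) (sym a) m , subst (_< N) (sym b) t′ , s
        ... | rests _ a b   | h , m , t′ , s = h , subst (_< N) (sym a) m , subst (_< N) (sym b) t′ , s
        waiting′ : ∀ v → mark (X′ v) ≡ q → suc t * suc β ≤ ∑ (ports v) (potential X′ (suc t) v)
        waiting′ v e with outcome v
        ... | joins _ _ a _ = contradiction (trans (sym a) e) (<⇒≢ (f<q X t v))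
        ... | rests ne a _  = contradiction (trans (sym a) e) ne
        ... | waits a many _ _ = begin
          suc β + t * suc β                                             ≤⟨ +-mono-≤ many (waiting v a) ⟩
          conflicts v + ∑ (ports v) (potential X t v)                   ≡⟨ sym (∑-+ (ports v) _ _) ⟩
          ∑ (ports v) (λ u → 𝟙 (conflict X t v u) + potential X t v u)  ≤⟨ ∑-mono (ports v) (λ u _ → potential-grows v u) ⟩
          ∑ (ports v) (potential X′ (suc t) v) ∎
          where open ≤-Reasoning
        settled′ : ∀ v → mark (X′ v) ≢ q → mark (X′ v) < q × time (X′ v) < suc t × ∑ (ports v) (λ u → 𝟙 (out (X′ v) (X′ u))) ≤ β
        settled′ v ne with outcome v
        ... | joins a few b c = subst (_< q) (sym b) (f<q X t v) , s≤s (≤-reflexive c) ,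
          ≤-trans (∑-mono (ports v) (λ u _ → joined-out v u a b)) few
        ... | waits a _ b _   = contradiction (trans b a) ne
        ... | rests a b c with settled v a
        ...   | m , t′ , o = subst (_< q) (sym b) m , subst (_< suc t) (sym c) (m<n⇒m<1+n t′) ,
          ≤-trans (∑-mono (ports v) (λ u _ → settled-out v u t′ b c)) o

    partition-correct : ∀ X → Coloured q m X → Leads ports N X (partition D q β) (Partitioned q β m)
    partition-correct X C = leads-⇒ ports (partition D q β)
      (leads-loop ports _ Partitioning q (λ t Y t<q I → Partitioning.below I , partition-step t Y t<q I) 0 q X refl start)
      finish
      where
      start : Partitioning 0 X
      start = record
        { below   = Coloured.below C
        ; hue-pos = Coloured.hue-pos C
        ; hue-≤   = Coloured.hue-≤ C
        ; proper  = Coloured.proper C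
        ; waiting = λ v _ → z≤n
        ; settled = λ v ne → contradiction (Coloured.mark-≡ C v) ne
        }
      finish : ∀ Y → Partitioning q Y → Partitioned q β m Y
      finish Y I = record
        { below   = below
        ; hue-pos = hue-pos
        ; hue-≤   = hue-≤
        ; proper  = proper
        ; mark-<  = λ v → proj₁ (settled v (all-settled v))
        ; out-≤   = λ v → proj₂ (proj₂ (settled v (all-settled v)))
        }
        where
        open Partitioning I
        all-settled : ∀ v → mark (Y v) ≢ q
        all-settled v e = <⇒≱ Δ-small (begin
          q * suc β                          ≤⟨ waiting v e ⟩
          ∑ (ports v) (potential Y q v)      ≤⟨ ∑≤ (ports v) _ (D + D) limit ⟩
          length (ports v) * (D + D)         ≤⟨ *-monoˡ-≤ (D + D) (length-ports≤ G ports numbering v) ⟩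
          Δ * (D + D) ∎)
          where
          open ≤-Reasoning
          -- One D for the meetings of the two curves, the other for the meetings with the constant
          -- that u contributes after joining.
          limit : ∀ u → u ∈ ports v → potential Y q v u ≤ D + D
          limit u i = ≤-trans (≤-reflexive (sumTo-+ q _ _)) (+-mono-≤
            (curves-meet q pq D _ _ 0 0 (≤-<-trans (hue-≤ v) m<q^D) (≤-<-trans (hue-≤ u) m<q^D) (proper v u i))
            (curve-meets-constant q pq D _ 0 (mark (Y u)) (hue-pos v) (≤-<-trans (hue-≤ v) m<q^D)))

-- List colouring along the classes

∨-false⁻ : ∀ {a b} → 𝟙 a + 𝟙 b ≡ 0 → a ≡ false × b ≡ false
∨-false⁻ {false} {false} e = refl , refl

sumTo-single : ∀ n a → sumTo n (λ x → 𝟙 (x ≡ᵇ a)) ≤ 1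
sumTo-single zero    a = z≤n
sumTo-single (suc n) a with n ≟ a
... | yes refl = ≤-reflexive (cong₂ _+_ (sumTo-0 n λ x x<n → cong 𝟙 (≡ᵇ-false (<⇒≢ x<n))) (cong 𝟙 (≡ᵇ-true {n} refl)))
... | no n≢a   = ≤-trans (+-mono-≤ (sumTo-single n a) (≤-reflexive (cong 𝟙 (≡ᵇ-false n≢a)))) (≤-reflexive (+-identityʳ 1))

sumTo-∧ʳ : ∀ n (P : ℕ → Bool) b k → sumTo n (𝟙 ∘ P) ≤ k → sumTo n (λ x → 𝟙 (P x ∧ b)) ≤ 𝟙 b * k
sumTo-∧ʳ n P true  k le = ≤-trans (sumTo-mono n λ x _ → 𝟙-≤ (proj₁ ∘ ∧-true⁻)) (≤-trans le (≤-reflexive (sym (+-identityʳ k))))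
sumTo-∧ʳ n P false k le = ≤-reflexive (sumTo-0 n λ x _ → cong 𝟙 (¬true⇒false λ e → true≢false (sym (proj₂ (∧-true⁻ {P x} e)))))

module _ (D s : ℕ) .{{_ : NonZero s}} where

  -- S has the final colour (a , b), encoded as b + a * s, and the curve passes through this point.
  blocks : ℕ → ℕ → ℕ → Reg → Bool
  blocks k ψ c S = (mark S <ᵇ k) ∧ (curve s D ψ c (hue S / s) ≡ᵇ (hue S % s))

  shiftStep : ℕ → ℕ → Step
  shiftStep Δ k R Rs = record R
    { shift = if mark R ≡ᵇ k then pick s (Δ / s) (λ c → ∑ Rs λ S → 𝟙 (blocks k (hue R) c S)) else shift R }

  -- The members of a class choose simultaneously, so a vertex stays off the whole curve of an
  -- out-neighbour rather than off one point of it. Every edge of the class has an endpoint that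
  -- does this.
  obstacles : ℕ → Reg → ℕ → Reg → ℕ
  obstacles k R x S =
    𝟙 ((curve s D (hue R) (shift R) x ≡ᵇ curve s D (hue S) (shift S) x) ∧ out R S) +
    𝟙 ((x ≡ᵇ hue S / s) ∧ blocks k (hue R) (shift R) S)

  colourStep : ℕ → Step
  colourStep k R Rs = record R
    { hue = if mark R ≡ᵇ k then curve s D (hue R) (shift R) x + x * s else hue R }
    where
    x : ℕ
    x = pick s 0 λ x → ∑ Rs (obstacles k R x)

  -- Two rounds per class: the curves to be avoided depend on the translations of the neighbours,
  -- which have to be announced before a point is chosen.
  listColouring : ℕ → ℕ → List Step
  listColouring Δ q = loop (λ k → shiftStep Δ k ∷ colourStep k ∷ []) 0 q

module _ {n : ℕ} (G : Graph n) (ports : Fin n → List (Fin n)) (numbering : IsPortNumbering G ports) (N : ℕ) where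
  open Network G ports numbering N

  adj-ports : ∀ {u v} → u ∈ ports v → v ∈ ports u
  adj-ports {u} {v} i = adj⇒∈ports G ports numbering (trans (adj-sym G u v) (∈ports⇒adj G ports numbering i))

  module _ (D s q β m : ℕ) .{{_ : NonZero s}} (ps : Prime s) (m<s^D : m < s ^ D) (room : β * D + Δ / s < s) (ss<N : s * s < N) where
    -- `hue` holds the input colour as long as the class is to come and the final colour afterwards,
    -- so properness makes sense on each side separately.
    record Listed (k : ℕ) (X : Fin n → Reg) : Set where
      field
        below   : ∀ v → Below N (X v)
        mark-<  : ∀ v → mark (X v) < q
        out-≤   : ∀ v → ∑ (ports v) (λ u → 𝟙 (out (X v) (X u))) ≤ β
        late    : ∀ v → k ≤ mark (X v) → hue (X v) < s ^ D
        early   : ∀ v → mark (X v) < k → hue (X v) < s * s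
        late-proper  : ∀ v u → u ∈ ports v → k ≤ mark (X v) → k ≤ mark (X u) → hue (X v) ≢ hue (X u)
        early-proper : ∀ v u → u ∈ ports v → mark (X v) < k → mark (X u) < k → hue (X v) ≢ hue (X u)

    Shifted : ℕ → (Fin n → Reg) → Set
    Shifted k X = ∀ v → mark (X v) ≡ k → ∑ (ports v) (λ u → 𝟙 (blocks D s k (hue (X v)) (shift (X v)) (X u))) ≤ Δ / s

    module _ (k : ℕ) (X : Fin n → Reg) (L : Listed k X) where
      open Listed L

      private
        X′ : Fin n → Reg
        X′ = exec ports (shiftStep D s Δ k) X
        g : Fin n → ℕ → ℕ
        g v c = ∑ (map X (ports v)) λ S → 𝟙 (blocks D s k (hue (X v)) c S)
        total : ∀ v → sumTo s (g v) < s * suc (Δ / s)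
        total v = begin-strict
          sumTo s (g v)     ≤⟨ sumTo-mono s (λ c _ → ≤-reflexive (∑-map X (ports v) _)) ⟩
          sumTo s (λ c → ∑ (ports v) (λ u → 𝟙 (blocks D s k (hue (X v)) c (X u))))  ≡⟨ sumTo-∑ s (ports v) _ ⟩
          ∑ (ports v) (λ u → sumTo s (λ c → 𝟙 (blocks D s k (hue (X v)) c (X u)))) ≤⟨ ∑≤ (ports v) _ 1 (λ u _ → single v u) ⟩
          length (ports v) * 1    ≡⟨ *-identityʳ _ ⟩
          length (ports v)        ≤⟨ length-ports≤ G ports numbering v ⟩
          Δ                       ≡⟨ m≡m%n+[m/n]*n Δ s ⟩
          Δ % s + Δ / s * s       <⟨ +-monoˡ-< (Δ / s * s) (m%n<n Δ s) ⟩
          s + Δ / s * s           ≡⟨ *-comm (suc (Δ / s)) s ⟩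
          s * suc (Δ / s) ∎
          where
          open ≤-Reasoning
          single : ∀ v u → sumTo s (λ c → 𝟙 (blocks D s k (hue (X v)) c (X u))) ≤ 1
          single v u = ≤-trans (sumTo-mono s λ c _ → 𝟙-≤ (proj₂ ∘ ∧-true⁻ {mark (X u) <ᵇ k}))
            (shifts-meet-constant s ps D (hue (X v)) (hue (X u) / s) (hue (X u)))
        s<N : s < N
        s<N = ≤-<-trans (m≤m*n s s) ss<N

      shift-listed : Listed k X′
      shift-listed = record
        { below = below′ ; mark-< = mark-< ; out-≤ = out-≤ ; late = late ; early = early
        ; late-proper = late-proper ; early-proper = early-proper }
        where
        below′ : ∀ v → Below N (X′ v)
        below′ v with below v | mark (X v) ≡ᵇ k
        ... | h , m , t , _ | true  = h , m , t , <-trans (proj₁ (pick-spec s (Δ / s) (g v) (total v))) s<N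
        ... | b             | false = b

      shift-shifted : Shifted k X′
      shift-shifted v e = ≤-trans (≤-reflexive (trans (cong (λ c → ∑ (ports v) (λ u → 𝟙 (blocks D s k (hue (X v)) c (X u)))) (if-true (≡ᵇ-true e)))
        (sym (∑-map X (ports v) _)))) (proj₂ (pick-spec s (Δ / s) (g v) (total v)))

    module _ (k : ℕ) (X : Fin n → Reg) (L : Listed k X) (S : Shifted k X) where
      open Listed L

      private
        X′ : Fin n → Reg
        X′ = exec ports (colourStep D s k) X
        f : ℕ → Fin n → ℕ
        f x v = curve s D (hue (X v)) (shift (X v)) x
        f<s : ∀ x v → f x v < s
        f<s x v = m%n<n _ s
        h : Fin n → ℕ → ℕ
        h v x = ∑ (map X (ports v)) (obstacles D s k (X v) x)
        outs blks : Fin n → Fin n → Bool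
        outs v u = out (X v) (X u)
        blks v u = blocks D s k (hue (X v)) (shift (X v)) (X u)

        total : ∀ v → mark (X v) ≡ k → sumTo s (h v) < s * 1
        total v e = begin-strict
          sumTo s (h v)     ≤⟨ sumTo-mono s (λ x _ → ≤-reflexive (∑-map X (ports v) _)) ⟩
          sumTo s (λ x → ∑ (ports v) (λ u → obstacles D s k (X v) x (X u)))  ≡⟨ sumTo-∑ s (ports v) _ ⟩
          ∑ (ports v) (λ u → sumTo s (λ x → obstacles D s k (X v) x (X u))) ≤⟨ ∑-mono (ports v) each ⟩
          ∑ (ports v) (λ u → 𝟙 (outs v u) * D + 𝟙 (blks v u) * 1)   ≡⟨ ∑-+ (ports v) _ _ ⟩
          ∑ (ports v) (λ u → 𝟙 (outs v u) * D) + ∑ (ports v) (λ u → 𝟙 (blks v u) * 1)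
            ≡⟨ cong₂ _+_ (∑-*ʳ (ports v) (𝟙 ∘ outs v) D) (trans (∑-*ʳ (ports v) (𝟙 ∘ blks v) 1) (*-identityʳ _)) ⟩
          ∑ (ports v) (𝟙 ∘ outs v) * D + ∑ (ports v) (𝟙 ∘ blks v) ≤⟨ +-mono-≤ (*-monoˡ-≤ D (out-≤ v)) (S v e) ⟩
          β * D + Δ / s  <⟨ room ⟩
          s              ≡⟨ sym (*-identityʳ s) ⟩
          s * 1 ∎
          where
          open ≤-Reasoning
          each : ∀ u → u ∈ ports v → sumTo s (λ x → obstacles D s k (X v) x (X u)) ≤ 𝟙 (outs v u) * D + 𝟙 (blks v u) * 1
          each u i = ≤-trans (≤-reflexive (sumTo-+ s _ _)) (+-mono-≤ meetings (sumTo-∧ʳ s _ (blks v u) 1 (sumTo-single s (hue (X u) / s))))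
            where
            meetings : sumTo s (λ x → 𝟙 ((f x v ≡ᵇ f x u) ∧ outs v u)) ≤ 𝟙 (outs v u) * D
            meetings with outs v u in o
            ... | false = never-out
              where
              never-out : sumTo s (λ x → 𝟙 ((f x v ≡ᵇ f x u) ∧ false)) ≤ 0
              never-out = ≤-reflexive (sumTo-0 s λ x _ → cong 𝟙 (¬true⇒false λ t → true≢false (sym (proj₂ (∧-true⁻ {f x v ≡ᵇ f x u} t)))))
            ... | true  = sumTo-∧ʳ s _ true D (curves-meet s ps D _ _ _ _ (late v v-late) (late u u-late) (late-proper v u i v-late u-late))
              where
              v-late : k ≤ mark (X v)
              v-late = ≤-reflexive (sym e)
              u-late : k ≤ mark (X u)
              u-late = ≤-reflexive (trans (sym e) (≡ᵇ-true⁻ (proj₁ (∧-true⁻ {mark (X v) ≡ᵇ mark (X u)} o))))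

        x : Fin n → ℕ
        x v = pick s 0 (h v)

        x<s : ∀ v → mark (X v) ≡ k → x v < s
        x<s v e = proj₁ (pick-spec s 0 (h v) (total v e))

        clear : ∀ v → mark (X v) ≡ k → ∀ u → u ∈ ports v → obstacles D s k (X v) (x v) (X u) ≡ 0
        clear v e u i = ∑≡0⇒≡0 (ports v) _ i (≤-trans (≤-reflexive (sym (∑-map X (ports v) _))) (proj₂ (pick-spec s 0 (h v) (total v e))))

        colour : Fin n → ℕ
        colour v = f (x v) v + x v * s

        colour< : ∀ v → mark (X v) ≡ k → colour v < s * s
        colour< v e = digits-< s s (f<s (x v) v) (x<s v e)

        coloured : ∀ v → mark (X v) ≡ k → hue (X′ v) ≡ colour v
        coloured v e = if-true (≡ᵇ-true e)

        kept : ∀ v → mark (X v) ≢ k → hue (X′ v) ≡ hue (X v)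
        kept v ne = if-false (≡ᵇ-false ne)

        avoids-out : ∀ v u → mark (X v) ≡ k → mark (X u) ≡ k → u ∈ ports v → time (X u) ≤ time (X v) → colour v ≢ colour u
        avoids-out v u v≡k u≡k i le e = true≢false (trans (sym meeting) (proj₁ (∨-false⁻ (clear v v≡k u i))))
          where
          x≡ : x v ≡ x u
          x≡ = trans (sym (high s _ (x v) (f<s (x v) v))) (trans (cong (_/ s) e) (high s _ (x u) (f<s (x u) u)))
          f≡ : f (x v) v ≡ f (x v) u
          f≡ = trans (sym (low s _ (x v) (f<s (x v) v))) (trans (cong (_% s) e) (trans (low s _ (x u) (f<s (x u) u)) (cong (λ z → f z u) (sym x≡))))
          meeting : (f (x v) v ≡ᵇ f (x v) u) ∧ outs v u ≡ true
          meeting = ∧-true (≡ᵇ-true f≡) (∧-true (≡ᵇ-true (trans v≡k (sym u≡k))) (T⇒≡ (≤⇒≤ᵇ le)))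

        avoids-early : ∀ v u → mark (X v) ≡ k → mark (X u) < k → u ∈ ports v → colour v ≢ hue (X u)
        avoids-early v u v≡k u<k i e = true≢false (trans (sym blocked) (proj₂ (∨-false⁻ {(f (x v) v ≡ᵇ f (x v) u) ∧ outs v u} (clear v v≡k u i))))
          where
          x≡ : x v ≡ hue (X u) / s
          x≡ = trans (sym (high s _ (x v) (f<s (x v) v))) (cong (_/ s) e)
          f≡ : f (hue (X u) / s) v ≡ hue (X u) % s
          f≡ = trans (cong (λ z → f z v) (sym x≡)) (trans (sym (low s _ (x v) (f<s (x v) v))) (cong (_% s) e))
          blocked : (x v ≡ᵇ hue (X u) / s) ∧ blks v u ≡ true
          blocked = ∧-true (≡ᵇ-true x≡) (∧-true (T⇒≡ (<⇒<ᵇ u<k)) (≡ᵇ-true f≡))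

      colour-listed : Listed (suc k) X′
      colour-listed = record
        { below = below′ ; mark-< = mark-< ; out-≤ = out-≤ ; late = late′ ; early = early′
        ; late-proper = late-proper′ ; early-proper = early-proper′ }
        where
        below′ : ∀ v → Below N (X′ v)
        below′ v with mark (X v) ≟ k | below v
        ... | yes e | h , b = subst (_< N) (sym (coloured v e)) (<-trans (colour< v e) ss<N) , b
        ... | no ne | h , b = subst (_< N) (sym (kept v ne)) h , b
        >⇒≢k : ∀ {j} → suc k ≤ j → j ≢ k
        >⇒≢k lt e = <⇒≢ lt (sym e)
        late′ : ∀ v → suc k ≤ mark (X v) → hue (X′ v) < s ^ D
        late′ v lt = subst (_< s ^ D) (sym (kept v (>⇒≢k lt))) (late v (<⇒≤ lt))
        early′ : ∀ v → mark (X v) < suc k → hue (X′ v) < s * s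
        early′ v lt with mark (X v) ≟ k
        ... | yes e = subst (_< s * s) (sym (coloured v e)) (colour< v e)
        ... | no ne = subst (_< s * s) (sym (kept v ne)) (early v (≤∧≢⇒< (≤-pred lt) ne))
        late-proper′ : ∀ v u → u ∈ ports v → suc k ≤ mark (X v) → suc k ≤ mark (X u) → hue (X′ v) ≢ hue (X′ u)
        late-proper′ v u i lt lt′ e = late-proper v u i (<⇒≤ lt) (<⇒≤ lt′)
          (trans (sym (kept v (>⇒≢k lt))) (trans e (kept u (>⇒≢k lt′))))
        early-proper′ : ∀ v u → u ∈ ports v → mark (X v) < suc k → mark (X u) < suc k → hue (X′ v) ≢ hue (X′ u)
        early-proper′ v u i lt lt′ e with mark (X v) ≟ k | mark (X u) ≟ k
        ... | no v≢k  | no u≢k  = early-proper v u i (≤∧≢⇒< (≤-pred lt) v≢k) (≤∧≢⇒< (≤-pred lt′) u≢k)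
                                    (trans (sym (kept v v≢k)) (trans e (kept u u≢k)))
        ... | yes v≡k | no u≢k  = avoids-early v u v≡k (≤∧≢⇒< (≤-pred lt′) u≢k) i (trans (sym (coloured v v≡k)) (trans e (kept u u≢k)))
        ... | no v≢k  | yes u≡k = avoids-early u v u≡k (≤∧≢⇒< (≤-pred lt) v≢k) (adj-ports i)
                                    (trans (sym (coloured u u≡k)) (trans (sym e) (kept v v≢k)))
        ... | yes v≡k | yes u≡k with ≤-total (time (X u)) (time (X v))
        ...   | inj₁ le = avoids-out v u v≡k u≡k i le (trans (sym (coloured v v≡k)) (trans e (coloured u u≡k)))
        ...   | inj₂ le = avoids-out u v u≡k v≡k (adj-ports i) le (trans (sym (coloured u u≡k)) (trans (sym e) (coloured v v≡k)))

    record Final (X : Fin n → Reg) : Set where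
      field
        below  : ∀ v → Below N (X v)
        hue-<  : ∀ v → hue (X v) < s * s
        proper : Proper X

    listColouring-correct : ∀ X → Partitioned q β m X → Leads ports N X (listColouring D s Δ q) Final
    listColouring-correct X P = leads-⇒ ports (listColouring D s Δ q)
       (leads-loop ports _ Listed q (λ k Y _ L → Listed.below L , Listed.below (shift-listed k Y L) ,
          colour-listed k _ (shift-listed k Y L) (shift-shifted k Y L)) 0 q X refl start) finish
      where
      open Partitioned P
      start : Listed 0 X
      start = record
        { below = below ; mark-< = mark-< ; out-≤ = out-≤ ; late = λ v _ → ≤-<-trans (hue-≤ v) m<s^D ; early = λ v ()
        ; late-proper = λ v u i _ _ → proper v u i ; early-proper = λ v u i () }
      finish : ∀ Y → Listed q Y → Final Y
      finish Y L = record
        { below  = Listed.below L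
        ; hue-<  = λ v → Listed.early L v (Listed.mark-< L v)
        ; proper = λ v u i → Listed.early-proper L v u i (Listed.mark-< L v) (Listed.mark-< L u) }

-- Ruling sets from colourings

withinHops-suc : ∀ {n} {G : Graph n} {i u v} → WithinHops G i u v → WithinHops G (suc i) u v
withinHops-suc stay      = stay
withinHops-suc (hop e w) = hop e (withinHops-suc w)

-- Marks: 2 for candidates, 1 for elected vertices, 0 for the others.
resetStep : Step
resetStep R Rs = record R { mark = 2 }

module _ (b : ℕ) .{{_ : NonZero b}} where

  electStep : ℕ → Step
  electStep a R Rs = record R
    { mark = if (mark R ≡ᵇ 2) ∧ (hue R % b ≡ᵇ a)
             then (if ∑ Rs (λ S → 𝟙 ((mark S ≡ᵇ 1) ∧ (hue S / b ≡ᵇ hue R / b))) ≡ᵇ 0 then 1 else 0)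
             else mark R }

  advanceStep : Step
  advanceStep R Rs = record R { hue = hue R / b ; mark = if mark R ≡ᵇ 1 then 2 else 0 }

  level : List Step
  level = loop (λ a → electStep a ∷ []) 0 b ++ (advanceStep ∷ [])

  ruling : ℕ → List Step
  ruling r = resetStep ∷ loop (λ _ → level) 0 r

module _ {n : ℕ} (G : Graph n) (ports : Fin n → List (Fin n)) (numbering : IsPortNumbering G ports) (N : ℕ) where
  open Network G ports numbering N using (Proper)

  module _ (b r : ℕ) .{{_ : NonZero b}} (2<N : 2 < N) where

    -- The candidates are properly coloured by the r ∸ i digits that remain. When no digit is left,
    -- this says that they are independent.
    record Level (i : ℕ) (X : Fin n → Reg) : Set where
      field
        below     : ∀ v → Below N (X v)
        hue-<     : ∀ v → hue (X v) < b ^ (r ∸ i)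
        mark-≢1   : ∀ v → mark (X v) ≢ 1
        rivals    : ∀ v u → u ∈ ports v → mark (X v) ≡ 2 → mark (X u) ≡ 2 → hue (X v) ≢ hue (X u)
        dominated : ∀ v → ∃ λ u → mark (X u) ≡ 2 × WithinHops G i u v

    -- A candidate ceases to be one by being elected or by having an elected neighbour that agrees
    -- in the other digits; the latter costs the one additional hop in `dominated`.
    record Electing (i a : ℕ) (X : Fin n → Reg) : Set where
      field
        below     : ∀ v → Below N (X v)
        hue-<     : ∀ v → hue (X v) < b ^ (r ∸ i)
        pending   : ∀ v → mark (X v) ≡ 2 → a ≤ hue (X v) % b
        rivals    : ∀ v u → u ∈ ports v → mark (X v) ≡ 2 → mark (X u) ≡ 2 → hue (X v) ≢ hue (X u)
        winners   : ∀ v u → u ∈ ports v → mark (X v) ≡ 1 → mark (X u) ≡ 1 → hue (X v) / b ≢ hue (X u) / b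
        dominated : ∀ v → ∃ λ u → (mark (X u) ≡ 2 × WithinHops G i u v) ⊎ (mark (X u) ≡ 1 × WithinHops G (suc i) u v)

    module _ (i a : ℕ) (X : Fin n → Reg) (E : Electing i a X) where
      open Electing E

      private
        X′ : Fin n → Reg
        X′ = exec ports (electStep b a) X

        won : Fin n → Fin n → Bool
        won v u = (mark (X u) ≡ᵇ 1) ∧ (hue (X u) / b ≡ᵇ hue (X v) / b)

        data Outcome (v : Fin n) : Set where
          wins  : mark (X v) ≡ 2 → hue (X v) % b ≡ a → mark (X′ v) ≡ 1 → (∀ u → u ∈ ports v → won v u ≡ false) → Outcome v
          loses : mark (X v) ≡ 2 → hue (X v) % b ≡ a → mark (X′ v) ≡ 0 → (∃ λ u → u ∈ ports v × won v u ≡ true) → Outcome v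
          waits : mark (X′ v) ≡ mark (X v) → (mark (X v) ≡ 2 → hue (X v) % b ≢ a) → Outcome v

        ∑-positive : ∀ (P : Fin n → Bool) us → ∑ us (𝟙 ∘ P) ≢ 0 → ∃ λ u → u ∈ us × P u ≡ true
        ∑-positive P []       ne = contradiction refl ne
        ∑-positive P (u ∷ us) ne with P u in e
        ... | true  = u , here refl , e
        ... | false with ∑-positive P us ne
        ...   | w , i , t = w , there i , t

        outcome : ∀ v → Outcome v
        outcome v with mark (X v) ≟ 2 | hue (X v) % b ≟ a
        ... | no ne | _     = waits (if-false (¬true⇒false λ t → ne (≡ᵇ-true⁻ (proj₁ (∧-true⁻ t))))) λ e → contradiction e ne
        ... | yes _ | no ne = waits (if-false (¬true⇒false λ t → ne (≡ᵇ-true⁻ (proj₂ (∧-true⁻ {mark (X v) ≡ᵇ 2} t))))) λ _ → ne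
        ... | yes e | yes e′ with ∑ (ports v) (𝟙 ∘ won v) ≟ 0
        ...   | yes z = wins e e′ (trans (if-true (∧-true (≡ᵇ-true e) (≡ᵇ-true e′))) (if-true (≡ᵇ-true (trans (∑-map X (ports v) _) z))))
                          λ u i → 𝟙-0 (∑≡0⇒≡0 (ports v) (𝟙 ∘ won v) i (≤-reflexive z))
          where
          𝟙-0 : ∀ {b} → 𝟙 b ≡ 0 → b ≡ false
          𝟙-0 {false} _ = refl
        ...   | no nz = loses e e′ (trans (if-true (∧-true (≡ᵇ-true e) (≡ᵇ-true e′))) (if-false (≡ᵇ-false λ z → nz (trans (sym (∑-map X (ports v) _)) z))))
                          (∑-positive (won v) (ports v) nz)

        divmod : ∀ {m k} → m % b ≡ a → k % b ≡ a → m / b ≡ k / b → m ≡ k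
        divmod {m} {k} e e′ d = trans (m≡m%n+[m/n]*n m b) (trans (cong₂ (λ x y → x + y * b) (trans e (sym e′)) d) (sym (m≡m%n+[m/n]*n k b)))

      -- Neighbours elected in the same round share the digit a, so by `rivals` they differ in the
      -- other digits. A vertex elected in a later round has checked the earlier ones itself.
      elect-step : Electing i (suc a) X′
      elect-step = record { below = below′ ; hue-< = hue-< ; pending = pending′ ; rivals = rivals′ ; winners = winners′ ; dominated = dominated′ }
        where
        below′ : ∀ v → Below N (X′ v)
        below′ v with below v | outcome v
        ... | h , m , t | wins _ _ e _  = h , subst (_< N) (sym e) (<-trans (s≤s (s≤s z≤n)) 2<N) , t
        ... | h , m , t | loses _ _ e _ = h , subst (_< N) (sym e) (<-trans (s≤s z≤n) 2<N) , t
        ... | h , m , t | waits e _     = h , subst (_< N) (sym e) m , t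
        still : ∀ v → mark (X′ v) ≡ 2 → mark (X v) ≡ 2 × hue (X v) % b ≢ a
        still v m with outcome v
        ... | wins _ _ e _  with () ← trans (sym e) m
        ... | loses _ _ e _ with () ← trans (sym e) m
        ... | waits e ne    = trans (sym e) m , ne (trans (sym e) m)
        pending′ : ∀ v → mark (X′ v) ≡ 2 → suc a ≤ hue (X v) % b
        pending′ v m with still v m
        ... | e , ne = ≤∧≢⇒< (pending v e) λ z → ne (sym z)
        rivals′ : ∀ v u → u ∈ ports v → mark (X′ v) ≡ 2 → mark (X′ u) ≡ 2 → hue (X v) ≢ hue (X u)
        rivals′ v u i e e′ = rivals v u i (proj₁ (still v e)) (proj₁ (still u e′))
        winners′ : ∀ v u → u ∈ ports v → mark (X′ v) ≡ 1 → mark (X′ u) ≡ 1 → hue (X v) / b ≢ hue (X u) / b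
        winners′ v u i m m′ d with outcome v | outcome u
        ... | loses _ _ e _   | _                  with () ← trans (sym e) m
        ... | _               | loses _ _ e _      with () ← trans (sym e) m′
        winners′ v u i m m′ d | wins e h _ _    | wins e′ h′ _ _     = rivals v u i e e′ (divmod h h′ d)
        winners′ v u i m m′ d | wins _ _ _ none | waits e _          = true≢false (trans (sym (∧-true (≡ᵇ-true (trans (sym e) m′)) (≡ᵇ-true (sym d)))) (none u i))
        winners′ v u i m m′ d | waits e _       | wins _ _ _ none    =
          true≢false (trans (sym (∧-true (≡ᵇ-true (trans (sym e) m)) (≡ᵇ-true d))) (none v (adj-ports G ports numbering N i)))
        winners′ v u i m m′ d | waits e _       | waits e′ _         = winners v u i (trans (sym e) m) (trans (sym e′) m′) d
        keep : ∀ u → mark (X u) ≡ 1 → mark (X′ u) ≡ 1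
        keep u m with outcome u
        ... | wins e _ _ _  with () ← trans (sym m) e
        ... | loses e _ _ _ with () ← trans (sym m) e
        ... | waits e _     = trans e m
        dominated′ : ∀ v → ∃ λ u → (mark (X′ u) ≡ 2 × WithinHops G i u v) ⊎ (mark (X′ u) ≡ 1 × WithinHops G (suc i) u v)
        dominated′ v with dominated v
        ... | u , inj₂ (m , w) = u , inj₂ (keep u m , w)
        ... | u , inj₁ (m , w) with outcome u
        ...   | wins _ _ e _  = u , inj₂ (e , withinHops-suc w)
        ...   | waits e _     = u , inj₁ (trans e m , w)
        ...   | loses _ _ _ (x , j , t) = x , inj₂ (keep x (≡ᵇ-true⁻ (proj₁ (∧-true⁻ t))) , hop (trans (adj-sym G x u) (∈ports⇒adj G ports numbering j)) w)

    level-correct : ∀ i X → i < r → Level i X → Leads ports N X (level b) (Level (suc i))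
    level-correct i X i<r L = leads-++ ports (loop (λ a → electStep b a ∷ []) 0 b) (advanceStep b ∷ [])
       (leads-loop ports _ (Electing i) b (λ a Y _ E → Electing.below E , elect-step i a Y E) 0 b X refl start)
       (λ Y E → Electing.below E , advance Y E)
       where
       start : Electing i 0 X
       start = record
         { below = below ; hue-< = hue-< ; pending = λ v _ → z≤n ; rivals = rivals
         ; winners = λ v u _ e _ → contradiction e (mark-≢1 v)
         ; dominated = λ v → proj₁ (dominated v) , inj₁ (proj₂ (dominated v)) }
         where open Level L
       advance : ∀ Y → Electing i b Y → Level (suc i) (exec ports (advanceStep b) Y)
       advance Y E = record
         { below     = λ v → ≤-<-trans (m/n≤m (hue (Y v)) b) (proj₁ (below v)) , mark<N v , proj₂ (proj₂ (below v))
         ; hue-<     = λ v → m<n*o⇒m/o<n (<-≤-trans (hue-< v) (≤-reflexive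
                         (trans (cong (b ^_) (+-∸-assoc 1 i<r)) (*-comm b _))))
         ; mark-≢1   = mark≢1
         ; rivals    = λ v u j e e′ → winners v u j (elected v e) (elected u e′)
         ; dominated = λ v → dominated′ v (dominated v)
         }
         where
         open Electing E
         Y′ : Fin n → Reg
         Y′ = exec ports (advanceStep b) Y
         mark<N : ∀ v → mark (Y′ v) < N
         mark<N v with mark (Y v) ≡ᵇ 1
         ... | true  = 2<N
         ... | false = <-trans (s≤s z≤n) 2<N
         mark≢1 : ∀ v → mark (Y′ v) ≢ 1
         mark≢1 v with mark (Y v) ≡ᵇ 1
         ... | true  = λ ()
         ... | false = λ ()
         elected : ∀ v → mark (Y′ v) ≡ 2 → mark (Y v) ≡ 1
         elected v e with mark (Y v) ≡ᵇ 1 in m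
         ... | true = ≡ᵇ-true⁻ m
         dominated′ : ∀ v → (∃ λ u → (mark (Y u) ≡ 2 × WithinHops G i u v) ⊎ (mark (Y u) ≡ 1 × WithinHops G (suc i) u v)) →
           ∃ λ u → mark (Y′ u) ≡ 2 × WithinHops G (suc i) u v
         -- After b rounds every possible digit has had its turn, so no candidate is left undecided.
         dominated′ v (u , inj₁ (m , w)) = contradiction (m%n<n (hue (Y u)) b) (≤⇒≯ (pending u m))
         dominated′ v (u , inj₂ (m , w)) = u , if-true (≡ᵇ-true m) , w

    Ruled : (Fin n → Reg) → Set
    Ruled X = IsRulingSet G r (λ v → mark (X v) ≡ᵇ 2)

    ruling-correct : ∀ X → (∀ v → Below N (X v)) → (∀ v → hue (X v) < b ^ r) → Proper X → Leads ports N X (ruling b r) Ruled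
    ruling-correct X bounded hue<b^r proper = bounded ,
       leads-⇒ ports (loop (λ _ → level b) 0 r) (leads-loop ports _ Level r level-correct 0 r _ refl start) finish
       where
       start : Level 0 (exec ports resetStep X)
       start = record
         { below = λ v → proj₁ (bounded v) , 2<N , proj₂ (proj₂ (bounded v)) ; hue-< = hue<b^r ; mark-≢1 = λ v ()
         ; rivals = λ v u i _ _ → proper v u i ; dominated = λ v → v , refl , stay }
       finish : ∀ Y → Level r Y → Ruled Y
       finish Y L = independent , λ v → proj₁ (dominated v) , ≡ᵇ-true (proj₁ (proj₂ (dominated v))) , proj₂ (proj₂ (dominated v))
         where
         open Level L
         zero-hue : ∀ v → hue (Y v) ≡ 0
         zero-hue v = n<1⇒n≡0 (<-≤-trans (hue-< v) (≤-reflexive (cong (b ^_) (n∸n≡0 r))))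
         independent : ∀ u v → (mark (Y u) ≡ᵇ 2) ≡ true → (mark (Y v) ≡ᵇ 2) ≡ true → adj G u v ≡ false
         independent u v e e′ = ¬true⇒false λ t → rivals u v (adj⇒∈ports G ports numbering t) (≡ᵇ-true⁻ e) (≡ᵇ-true⁻ e′)
           (trans (zero-hue u) (sym (zero-hue v)))

-- Choice of parameters

least : ∀ {P : ℕ → Set} → (∀ n → Dec (P n)) → ∀ b → P b → ∃ λ m → P m × (∀ k → P k → m ≤ k)
least {P} P? zero    p = 0 , p , λ _ _ → z≤n
least {P} P? (suc b) p with P? 0
... | yes p₀ = 0 , p₀ , λ _ _ → z≤n
... | no ¬p₀ with least (P? ∘ suc) b p
...   | m , q , below = suc m , q , λ { zero p₀ → contradiction p₀ ¬p₀ ; (suc k) pk → s≤s (below k pk) }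

square-cancel : ∀ a b → a * a ≤ b * b → a ≤ b
square-cancel a b le = ≮⇒≥ λ lt → <⇒≱ (*-mono-< lt lt) le

-- For odd r the width T^(r/2) need not be an integer. The root rounded up is at most twice its
-- predecessor once it is at least 2, whence the factor 4.
approximate-sqrt : ∀ N → 1 ≤ N → ∃ λ w → N ≤ w * w × w * w ≤ 4 * N
approximate-sqrt N N≥1 with least (λ w → N ≤? w * w) N (m≤m*n N N {{>-nonZero N≥1}})
... | zero        , lo , _  = contradiction (≤-trans N≥1 lo) λ ()
... | suc zero    , lo , _  = 1 , lo , ≤-trans N≥1 (m≤n*m N 4)
... | suc (suc w) , lo , mn = suc (suc w) , lo , (begin
  suc (suc w) * suc (suc w)          ≤⟨ *-mono-≤ double double ⟩
  (suc w + suc w) * (suc w + suc w)  ≡⟨ lemma (suc w) ⟩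
  4 * (suc w * suc w)                ≤⟨ *-monoʳ-≤ 4 (<⇒≤ (≰⇒> λ le → 1+n≰n (mn (suc w) le))) ⟩
  4 * N ∎)
  where
  open ≤-Reasoning
  double : suc (suc w) ≤ suc w + suc w
  double = s≤s (m≤n+m (suc w) w)
  lemma : ∀ a → (a + a) * (a + a) ≡ 4 * (a * a)
  lemma = solve-∀

n<2^n : ∀ n → n < 2 ^ n
n<2^n zero    = s≤s z≤n
n<2^n (suc n) = ≤-trans (s≤s (n<2^n n)) (≤-trans (≤-trans (≤-reflexive (+-comm 1 _)) (+-monoʳ-≤ (2 ^ n) (m^n>0 2 n)))
  (≤-reflexive (cong (λ z → 2 ^ n + z) (sym (+-identityʳ _)))))

n<2^suc⌊log₂n⌋ : ∀ n → n < 2 ^ suc ⌊log₂ n ⌋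
n<2^suc⌊log₂n⌋ n = ≰⇒> λ le → 1+n≰n (≤-trans (≤-reflexive (sym (⌊log₂[2^n]⌋≡n (suc ⌊log₂ n ⌋)))) (⌊log₂⌋-mono-≤ le))

⌊log₂n⌋<n : ∀ n → 1 ≤ n → ⌊log₂ n ⌋ < n
⌊log₂n⌋<n (suc n) _ = s≤s (≤-trans (⌊log₂⌋-mono-≤ (n<2^n n)) (≤-reflexive (⌊log₂[2^n]⌋≡n n)))

⌊log₂n⌋≥1 : ∀ n → 2 ≤ n → 1 ≤ ⌊log₂ n ⌋
⌊log₂n⌋≥1 n 2≤n = ≤-trans (≤-reflexive (sym (⌊log₂[2^n]⌋≡n 1))) (⌊log₂⌋-mono-≤ 2≤n)

-- `⌈log2⌉` recurses on the accessibility proof, from n + 2 to one plus the upper half of n, and the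
-- induction follows it.
n≤2^⌈log₂n⌉ : ∀ n → n ≤ 2 ^ ⌈log₂ n ⌉
n≤2^⌈log₂n⌉ n = by-halving n (<-wellFounded n)
  where
  by-halving : ∀ n (rec : Acc _<_ n) → n ≤ 2 ^ ⌈log2⌉ n rec
  by-halving zero          _        = z≤n
  by-halving (suc zero)    _        = s≤s z≤n
  by-halving (suc (suc n)) (acc rs) = begin
    2 + n                           ≡⟨ cong (λ z → 2 + z) (sym (⌊n/2⌋+⌈n/2⌉≡n n)) ⟩
    2 + (⌊ n /2⌋ + ⌈ n /2⌉)         ≤⟨ +-monoʳ-≤ 2 (+-monoˡ-≤ ⌈ n /2⌉ (⌊n/2⌋≤⌈n/2⌉ n)) ⟩
    2 + (⌈ n /2⌉ + ⌈ n /2⌉)         ≡⟨ lemma ⌈ n /2⌉ ⟩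
    2 * suc ⌈ n /2⌉                 ≤⟨ *-monoʳ-≤ 2 (by-halving (suc ⌈ n /2⌉) _) ⟩
    2 ^ ⌈log2⌉ (suc (suc n)) (acc rs) ∎
    where
    open ≤-Reasoning
    lemma : ∀ h → 2 + (h + h) ≡ 2 * suc h
    lemma = solve-∀

-- The empty graph is treated apart because the palette bounds need n ≥ 1.
leads-empty : (ports : Fin 0 → List (Fin 0)) → ∀ {N} fs X {P} → (∀ Y → P Y) → Leads ports N X fs P
leads-empty ports []       X p = p X
leads-empty ports (f ∷ fs) X p = (λ ()) , leads-empty ports fs _ p

*-distrib-^ : ∀ a b k → (a * b) ^ k ≡ a ^ k * b ^ k
*-distrib-^ a b zero    = refl
*-distrib-^ a b (suc k) = trans (cong (a * b *_) (*-distrib-^ a b k)) (lemma a b (a ^ k) (b ^ k))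
  where
  lemma : ∀ a b x y → a * b * (x * y) ≡ a * x * (b * y)
  lemma = solve-∀

length-partition : ∀ D q β .{{_ : NonZero q}} → length (partition D q β) ≡ q * 1
length-partition D q β = length-loop (λ x → partitionStep D q β x ∷ []) 1 (λ _ → refl) 0 q

length-listColouring : ∀ D s Δ q .{{_ : NonZero s}} → length (listColouring D s Δ q) ≡ q * 2
length-listColouring D s Δ q = length-loop (λ k → shiftStep D s Δ k ∷ colourStep D s k ∷ []) 2 (λ _ → refl) 0 q

length-ruling : ∀ b r .{{_ : NonZero b}} → length (ruling b r) ≡ suc (r * (b * 1 + 1))
length-ruling b r = cong suc (length-loop (λ _ → level b) (b * 1 + 1) (λ _ → trans (length-++ (loop (λ a → electStep b a ∷ []) 0 b))
  (cong (λ z → z + 1) (length-loop (λ a → electStep b a ∷ []) 1 (λ _ → refl) 0 b))) 0 r)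

module Parameters (C : ℕ) (primes : ∀ N → ∃ λ p → Prime p × N < p × (1 ≤ N → p ≤ C * N)) (r : ℕ) (2≤r : 2 ≤ r) (c : ℕ) where

  primeAbove : ℕ → ℕ
  primeAbove N = proj₁ (primes N)

  isPrime : ∀ N → Prime (primeAbove N)
  isPrime N = proj₁ (proj₂ (primes N))

  primeAbove> : ∀ N → N < primeAbove N
  primeAbove> N = proj₁ (proj₂ (proj₂ (primes N)))

  primeAbove≤ : ∀ N → 1 ≤ N → primeAbove N ≤ C * N
  primeAbove≤ N = proj₂ (proj₂ (proj₂ (primes N)))

  instance
    primeAbove≢0 : ∀ {N} → NonZero (primeAbove N)
    primeAbove≢0 {N} = prime⇒nonZero (isPrime N)

  -- `E` has to dominate the factors C, 2 c + 1 and 4 c₁ + 13 that occur in the field sizes. The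
  -- summand 6 is the first x with 4 x + 13 ≤ 2 ^ x.
  c₁ : ℕ
  c₁ = C + 2 * c + 6

  E : ℕ
  E = 2 ^ c₁

  -- Linial's reduction from palette Δ L reaches palette Δ ⌊log₂ L⌋ in one round, so log* n rounds suffice.
  palette : ℕ → ℕ → ℕ
  palette Δ L = (E * suc Δ * L) ^ 4

  degree₀ : ℕ → ℕ
  degree₀ n = suc (c * suc ⌊log₂ n ⌋)

  -- Enough binary digits for `palette Δ L` if l is ⌊log₂ L⌋. Estimating `suc Δ` by 2 ^ suc Δ makes
  -- the degree linear and the field quadratic in Δ, which the fourth power in the palette allows.
  degreeOf : ℕ → ℕ → ℕ
  degreeOf Δ l = suc (4 * (c₁ + suc Δ + suc l))

  field₀ : ℕ → ℕ → ℕ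
  field₀ n Δ = primeAbove (degree₀ n * suc Δ)

  fieldOf : ℕ → ℕ → ℕ
  fieldOf Δ l = primeAbove (degreeOf Δ l * suc Δ)

  -- It copies the recursion of `logStar-go`, so its length is log* n exactly and the round bound
  -- gets this term with factor one. The step from the identifiers to `palette Δ n` is counted with
  -- the constants.
  linial : ℕ → ℕ → ℕ → List Step
  linial Δ zero       L = []
  linial Δ (suc fuel) L = if L ≤ᵇ 1 then [] else
    (linialStep (degreeOf Δ ⌊log₂ L ⌋) (fieldOf Δ ⌊log₂ L ⌋) ∷ linial Δ fuel ⌊log₂ L ⌋)

  length-linial : ∀ Δ fuel L → length (linial Δ fuel L) ≡ logStar-go fuel L
  length-linial Δ zero       L = refl
  length-linial Δ (suc fuel) L with L ≤ᵇ 1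
  ... | true  = refl
  ... | false = cong suc (length-linial Δ fuel ⌊log₂ L ⌋)

  E-large : ∀ k → k ≤ c₁ → k ≤ E
  E-large k le = ≤-trans le (<⇒≤ (n<2^n c₁))

  C≤E : C ≤ E
  C≤E = E-large C (≤-trans (m≤m+n C (2 * c)) (m≤m+n _ 6))

  4c₁+13≤E : 4 * c₁ + 13 ≤ E
  4c₁+13≤E = bound c₁ (m≤n+m 6 (C + 2 * c))
    where
    open ≤-Reasoning
    lemma : ∀ y → 4 * (6 + suc y) + 13 ≡ (4 * (6 + y) + 13) + 4
    lemma = solve-∀
    four : ∀ y → 4 ≤ 2 ^ (6 + y)
    four y = ≤-trans (≤ᵇ⇒≤ 4 64 _) (^-monoʳ-≤ 2 (m≤m+n 6 y))
    go : ∀ y → 4 * (6 + y) + 13 ≤ 2 ^ (6 + y)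
    go zero    = ≤ᵇ⇒≤ 37 64 _
    go (suc y) = begin
      4 * (6 + suc y) + 13       ≡⟨ lemma y ⟩
      (4 * (6 + y) + 13) + 4     ≤⟨ +-mono-≤ (go y) (four y) ⟩
      2 ^ (6 + y) + 2 ^ (6 + y)  ≡⟨ cong (λ z → 2 ^ (6 + y) + z) (sym (+-identityʳ _)) ⟩
      2 * 2 ^ (6 + y)            ≡⟨ cong (2 ^_) (sym (+-suc 6 y)) ⟩
      2 ^ (6 + suc y) ∎
    bound : ∀ x → 6 ≤ x → 4 * x + 13 ≤ 2 ^ x
    bound x le = subst (λ z → 4 * z + 13 ≤ 2 ^ z) (m+[n∸m]≡n le) (go (x ∸ 6))

  -- The origin of the exponent 4: the prime is at most E² a² l², and the new colours are pairs of
  -- field elements.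
  fits : ∀ k d a l → 1 ≤ d * a → d ≤ k * (a * l) → 1 ≤ l → k ≤ E → primeAbove (d * a) * primeAbove (d * a) ≤ (E * a * l) ^ 4
  fits k d a l da≥1 d≤ l≥1 k≤E = begin
    p * p                                            ≤⟨ *-mono-≤ p≤ p≤ ⟩
    E * E * (a * a * (l * l)) * (E * E * (a * a * (l * l)))  ≡⟨ lemma′ E a l ⟩
    (E * a * l) ^ 4 ∎
    where
    open ≤-Reasoning
    p : ℕ
    p = primeAbove (d * a)
    lemma : ∀ C k a l → C * (k * (a * l) * a) ≡ C * k * (a * a * l)
    lemma = solve-∀
    lemma′ : ∀ E a l → E * E * (a * a * (l * l)) * (E * E * (a * a * (l * l))) ≡ E * a * l * (E * a * l * (E * a * l * (E * a * l * 1)))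
    lemma′ = solve-∀
    p≤ : p ≤ E * E * (a * a * (l * l))
    p≤ = begin
      p                          ≤⟨ primeAbove≤ (d * a) da≥1 ⟩
      C * (d * a)                ≤⟨ *-monoʳ-≤ C (*-monoˡ-≤ a d≤) ⟩
      C * (k * (a * l) * a)      ≡⟨ lemma C k a l ⟩
      C * k * (a * a * l)        ≤⟨ *-mono-≤ (*-mono-≤ C≤E k≤E) (*-monoʳ-≤ (a * a) (m≤m*n l l {{>-nonZero l≥1}})) ⟩
      E * E * (a * a * (l * l)) ∎

  fits₀ : ∀ n Δ → 1 ≤ n → field₀ n Δ * field₀ n Δ ≤ palette Δ n
  fits₀ n Δ n≥1 = fits (suc (2 * c)) (degree₀ n) (suc Δ) n (s≤s z≤n) small n≥1 (E-large _ large)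
    where
    open ≤-Reasoning
    large : suc (2 * c) ≤ c₁
    large = ≤-trans (≤-reflexive (+-comm 1 (2 * c))) (+-mono-≤ (m≤n+m (2 * c) C) (s≤s z≤n))
    lemma : ∀ c n → n + c * (n + n) ≡ suc (2 * c) * n
    lemma = solve-∀
    small : degree₀ n ≤ suc (2 * c) * (suc Δ * n)
    small = begin
      1 + c * suc ⌊log₂ n ⌋         ≤⟨ +-mono-≤ n≥1 (*-monoʳ-≤ c (≤-trans (⌊log₂n⌋<n n n≥1) (m≤m+n n n))) ⟩
      n + c * (n + n)               ≡⟨ lemma c n ⟩
      suc (2 * c) * n               ≤⟨ *-monoʳ-≤ (suc (2 * c)) (m≤n*m n (suc Δ)) ⟩
      suc (2 * c) * (suc Δ * n) ∎

  fitsOf : ∀ Δ l → 1 ≤ l → fieldOf Δ l * fieldOf Δ l ≤ palette Δ l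
  fitsOf Δ l l≥1 = fits (4 * c₁ + 13) (degreeOf Δ l) (suc Δ) l (s≤s z≤n) small l≥1 4c₁+13≤E
    where
    open ≤-Reasoning
    al : ℕ
    al = suc Δ * l
    instance
      l≢0 : NonZero l
      l≢0 = >-nonZero l≥1
      al≢0 : NonZero al
      al≢0 = m*n≢0 (suc Δ) l
    lemma : ∀ c a → a + 4 * (c * a + a + (a + a)) ≡ (4 * c + 13) * a
    lemma = solve-∀
    small : degreeOf Δ l ≤ (4 * c₁ + 13) * al
    small = begin
      1 + 4 * (c₁ + suc Δ + (1 + l))            ≤⟨ +-mono-≤ {1} (>-nonZero⁻¹ al) (*-monoʳ-≤ 4 (+-mono-≤ (+-mono-≤ (m≤m*n c₁ al) (m≤m*n (suc Δ) l)) (+-mono-≤ {1} (>-nonZero⁻¹ al) (m≤n*m l (suc Δ))))) ⟩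
      al + 4 * (c₁ * al + al + (al + al))       ≡⟨ lemma c₁ al ⟩
      (4 * c₁ + 13) * al ∎

  2^≤^ : ∀ d q → Prime q → 2 ^ d ≤ q ^ d
  2^≤^ d q pq = ^-monoˡ-≤ d (nonTrivial⇒n>1 q {{prime⇒nonTrivial pq}})

  palette< : ∀ Δ L → palette Δ L < fieldOf Δ ⌊log₂ L ⌋ ^ degreeOf Δ ⌊log₂ L ⌋
  palette< Δ L = begin-strict
    (E * suc Δ * L) ^ 4                                  ≤⟨ ^-monoˡ-≤ 4 (*-mono-≤ (*-monoʳ-≤ E (<⇒≤ (n<2^n (suc Δ)))) (<⇒≤ (n<2^suc⌊log₂n⌋ L))) ⟩
    (2 ^ c₁ * 2 ^ suc Δ * 2 ^ suc l) ^ 4                 ≡⟨ cong (_^ 4) (trans (cong (λ z → z * 2 ^ suc l) (sym (^-distribˡ-+-* 2 c₁ (suc Δ)))) (sym (^-distribˡ-+-* 2 (c₁ + suc Δ) (suc l)))) ⟩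
    (2 ^ (c₁ + suc Δ + suc l)) ^ 4                       ≡⟨ trans (^-*-assoc 2 (c₁ + suc Δ + suc l) 4) (cong (2 ^_) (*-comm (c₁ + suc Δ + suc l) 4)) ⟩
    2 ^ (4 * (c₁ + suc Δ + suc l))                       <⟨ ^-monoʳ-< 2 (s≤s (s≤s z≤n)) (n<1+n (4 * (c₁ + suc Δ + suc l))) ⟩
    2 ^ degreeOf Δ l                                     ≤⟨ 2^≤^ (degreeOf Δ l) (fieldOf Δ l) (isPrime _) ⟩
    fieldOf Δ l ^ degreeOf Δ l ∎
    where
    open ≤-Reasoning
    l : ℕ
    l = ⌊log₂ L ⌋

  ids< : ∀ n Δ → n ^ c < field₀ n Δ ^ degree₀ n
  ids< n Δ = begin-strict
    n ^ c                            ≤⟨ ^-monoˡ-≤ c (<⇒≤ (n<2^suc⌊log₂n⌋ n)) ⟩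
    (2 ^ suc ⌊log₂ n ⌋) ^ c          ≡⟨ trans (^-*-assoc 2 (suc ⌊log₂ n ⌋) c) (cong (2 ^_) (*-comm (suc ⌊log₂ n ⌋) c)) ⟩
    2 ^ (c * suc ⌊log₂ n ⌋)          <⟨ ^-monoʳ-< 2 (s≤s (s≤s z≤n)) (n<1+n (c * suc ⌊log₂ n ⌋)) ⟩
    2 ^ degree₀ n                    ≤⟨ 2^≤^ (degree₀ n) (field₀ n Δ) (isPrime _) ⟩
    field₀ n Δ ^ degree₀ n ∎
    where open ≤-Reasoning

  -- `e` is the number of digits that hold the fourth power of E (Δ + 1), with E (Δ + 1) at most the
  -- power r + 1 of the field size. In `κ`, the part 8 E is for that estimate and 2 e + 1 for
  -- `few-conflicts` and `room`. The primes are at most `γ` times T₁ or W, and the square of the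
  -- second is at most `g` times T₁ ^ r.
  e κ γ g : ℕ
  e = suc (suc r * 4)
  κ = 8 * E + suc (e + e)
  γ = suc (C * κ)
  g = 4 * (γ * γ)

  square≤power : ∀ Δ → Δ ^ 2 ≤ Δ ^ (r + 2)
  square≤power zero    = z≤n
  square≤power (suc Δ) = ^-monoʳ-≤ (suc Δ) (m≤n+m 2 r)

  -- Δ^(2/(r+2)) rounded up; by minimality the round bound holds for every t that the theorem
  -- admits.
  root : ∀ Δ → ∃ λ T → Δ ^ 2 ≤ T ^ (r + 2) × (∀ t → Δ ^ 2 ≤ t ^ (r + 2) → T ≤ t)
  root Δ = least (λ t → Δ ^ 2 ≤? t ^ (r + 2)) Δ (square≤power Δ)

  module _ (Δ : ℕ) where

    -- The successor keeps T₁ positive for Δ = 0, where the root is 0.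
    T₁ : ℕ
    T₁ = suc (proj₁ (root Δ))

    width : ∃ λ w → T₁ ^ r ≤ w * w × w * w ≤ 4 * T₁ ^ r
    width = approximate-sqrt (T₁ ^ r) (m^n>0 T₁ r)

    W q s b : ℕ
    W = proj₁ width
    q = primeAbove (κ * T₁)
    s = primeAbove (κ * W)
    b = suc g * T₁

    private
      T₁^r≤WW : T₁ ^ r ≤ W * W
      T₁^r≤WW = proj₁ (proj₂ width)

      WW≤4T₁^r : W * W ≤ 4 * T₁ ^ r
      WW≤4T₁^r = proj₂ (proj₂ width)

      -- Here r ≥ 2 enters. A field of size at least W then has at least T₁ elements as well, so Δ ≤
      -- W T₁ gives Δ / s ≤ W.
      T₁≤W : T₁ ≤ W
      T₁≤W = square-cancel T₁ W (begin
        T₁ * T₁  ≡⟨ cong (T₁ *_) (sym (*-identityʳ T₁)) ⟩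
        T₁ ^ 2   ≤⟨ ^-monoʳ-≤ T₁ 2≤r ⟩
        T₁ ^ r   ≤⟨ T₁^r≤WW ⟩
        W * W    ∎)
        where open ≤-Reasoning

      instance
        W≢0 : NonZero W
        W≢0 = >-nonZero (≤-trans (s≤s z≤n) T₁≤W)

      Δ≤WT₁ : Δ ≤ W * T₁
      Δ≤WT₁ = square-cancel Δ (W * T₁) (begin
        Δ * Δ                         ≡⟨ cong (Δ *_) (sym (*-identityʳ Δ)) ⟩
        Δ ^ 2                         ≤⟨ proj₁ (proj₂ (root Δ)) ⟩
        proj₁ (root Δ) ^ (r + 2)      ≤⟨ ^-monoˡ-≤ (r + 2) (n≤1+n _) ⟩
        T₁ ^ (r + 2)                  ≡⟨ ^-distribˡ-+-* T₁ r 2 ⟩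
        T₁ ^ r * T₁ ^ 2               ≤⟨ *-monoˡ-≤ (T₁ ^ 2) T₁^r≤WW ⟩
        W * W * T₁ ^ 2                ≡⟨ lemma W T₁ ⟩
        W * T₁ * (W * T₁) ∎)
        where
        open ≤-Reasoning
        lemma : ∀ w t → w * w * (t * (t * 1)) ≡ w * t * (w * t)
        lemma = solve-∀

      κ≥e+e : suc (e + e) ≤ κ
      κ≥e+e = m≤n+m _ (8 * E)

      palette-small : ∀ x → 1 < x → κ * T₁ ≤ x → palette Δ 1 < x ^ e
      palette-small x x>1 κT₁≤x = begin-strict
        (E * suc Δ * 1) ^ 4        ≤⟨ ^-monoˡ-≤ 4 base ⟩
        (x ^ suc r) ^ 4            ≡⟨ ^-*-assoc x (suc r) 4 ⟩
        x ^ (suc r * 4)            <⟨ ^-monoʳ-< x x>1 (n<1+n (suc r * 4)) ⟩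
        x ^ e ∎
        where
        open ≤-Reasoning
        lemma : ∀ E t u → E * (4 * u * t + 4 * u * t) * 1 ≡ 8 * E * t * u
        lemma = solve-∀
        W≤ : W ≤ 4 * T₁ ^ r
        W≤ = ≤-trans (m≤m*n W W) WW≤4T₁^r
        T₁≤x : T₁ ≤ x
        T₁≤x = ≤-trans (m≤n*m T₁ κ {{>-nonZero (≤-trans (s≤s z≤n) κ≥e+e)}}) κT₁≤x
        base : E * suc Δ * 1 ≤ x ^ suc r
        base = begin
          E * suc Δ * 1                                  ≤⟨ *-monoˡ-≤ 1 (*-monoʳ-≤ E (+-mono-≤ {1} (>-nonZero⁻¹ (4 * T₁ ^ r * T₁) {{m*n≢0 (4 * T₁ ^ r) T₁ {{m*n≢0 4 (T₁ ^ r) {{_}} {{m^n≢0 T₁ r}}}}}})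
                                                             (≤-trans Δ≤WT₁ (*-monoˡ-≤ T₁ W≤)))) ⟩
          E * (4 * T₁ ^ r * T₁ + 4 * T₁ ^ r * T₁) * 1    ≡⟨ lemma E T₁ (T₁ ^ r) ⟩
          8 * E * T₁ * T₁ ^ r                            ≤⟨ *-mono-≤ (≤-trans (*-monoˡ-≤ T₁ (m≤m+n (8 * E) _)) κT₁≤x) (^-monoˡ-≤ r T₁≤x) ⟩
          x * x ^ r ∎

    palette<q^e : palette Δ 1 < q ^ e
    palette<q^e = palette-small q (nonTrivial⇒n>1 q {{prime⇒nonTrivial (isPrime _)}}) (<⇒≤ (primeAbove> (κ * T₁)))

    palette<s^e : palette Δ 1 < s ^ e
    palette<s^e = palette-small s (nonTrivial⇒n>1 s {{prime⇒nonTrivial (isPrime _)}}) (≤-trans (*-monoʳ-≤ κ T₁≤W) (<⇒≤ (primeAbove> (κ * W))))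

    few-conflicts : Δ * (e + e) < q * suc W
    few-conflicts = begin-strict
      Δ * (e + e)         ≤⟨ *-mono-≤ Δ≤WT₁ (≤-trans (n≤1+n _) κ≥e+e) ⟩
      W * T₁ * κ          ≡⟨ lemma W T₁ κ ⟩
      κ * T₁ * W          <⟨ *-monoˡ-< W (primeAbove> (κ * T₁)) ⟩
      q * W               ≤⟨ *-monoʳ-≤ q (n≤1+n W) ⟩
      q * suc W ∎
      where
      open ≤-Reasoning
      lemma : ∀ w t k → w * t * k ≡ k * t * w
      lemma = solve-∀

    room : W * e + Δ / s < s
    room = begin-strict
      W * e + Δ / s       ≤⟨ +-monoʳ-≤ (W * e) (≤-trans (/-monoˡ-≤ s (≤-trans Δ≤WT₁ (*-monoʳ-≤ W T₁≤s))) (≤-reflexive (m*n/n≡m W s))) ⟩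
      W * e + W           ≡⟨ lemma W e ⟩
      suc e * W           ≤⟨ *-monoˡ-≤ W (≤-trans (s≤s (m≤m+n e e)) κ≥e+e) ⟩
      κ * W               <⟨ primeAbove> (κ * W) ⟩
      s ∎
      where
      open ≤-Reasoning
      lemma : ∀ w e → w * e + w ≡ suc e * w
      lemma = solve-∀
      T₁≤s : T₁ ≤ s
      T₁≤s = ≤-trans T₁≤W (≤-trans (m≤n*m W κ {{>-nonZero (≤-trans (s≤s z≤n) κ≥e+e)}}) (<⇒≤ (primeAbove> (κ * W))))

    q≤ : q ≤ γ * T₁
    q≤ = begin
      q              ≤⟨ primeAbove≤ (κ * T₁) (*-mono-≤ {1} (≤-trans (s≤s z≤n) κ≥e+e) (s≤s z≤n)) ⟩
      C * (κ * T₁)   ≡⟨ sym (*-assoc C κ T₁) ⟩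
      C * κ * T₁     ≤⟨ *-monoˡ-≤ T₁ (n≤1+n (C * κ)) ⟩
      γ * T₁ ∎
      where open ≤-Reasoning

    ss≤b^r : s * s ≤ b ^ r
    ss≤b^r = begin
      s * s                  ≤⟨ *-mono-≤ s≤ s≤ ⟩
      γ * W * (γ * W)        ≡⟨ lemma γ W ⟩
      γ * γ * (W * W)        ≤⟨ *-monoʳ-≤ (γ * γ) WW≤4T₁^r ⟩
      γ * γ * (4 * T₁ ^ r)   ≡⟨ lemma′ (γ * γ) (T₁ ^ r) ⟩
      g * T₁ ^ r             ≤⟨ *-monoˡ-≤ (T₁ ^ r) (≤-trans (n≤1+n g) (≤-trans (≤-reflexive (sym (*-identityʳ (suc g)))) (^-monoʳ-≤ (suc g) (≤-trans (s≤s z≤n) 2≤r)))) ⟩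
      suc g ^ r * T₁ ^ r     ≡⟨ sym (*-distrib-^ (suc g) T₁ r) ⟩
      b ^ r ∎
      where
      open ≤-Reasoning
      lemma : ∀ a w → a * w * (a * w) ≡ a * a * (w * w)
      lemma = solve-∀
      lemma′ : ∀ a t → a * (4 * t) ≡ 4 * a * t
      lemma′ = solve-∀
      s≤ : s ≤ γ * W
      s≤ = begin
        s              ≤⟨ primeAbove≤ (κ * W) (*-mono-≤ {1} (≤-trans (s≤s z≤n) κ≥e+e) (>-nonZero⁻¹ W)) ⟩
        C * (κ * W)    ≡⟨ sym (*-assoc C κ W) ⟩
        C * κ * W      ≤⟨ *-monoˡ-≤ W (n≤1+n (C * κ)) ⟩
        γ * W ∎

    T₁≤sucΔ : T₁ ≤ suc Δ
    T₁≤sucΔ = s≤s (proj₂ (proj₂ (root Δ)) Δ (square≤power Δ))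

  program : ℕ → ℕ → List Step
  program n Δ = linialStep (degree₀ n) (field₀ n Δ) ∷ linial Δ n n ++
    (partition e (q Δ) (W Δ) ++ (listColouring e (s Δ) Δ (q Δ) ++ ruling (b Δ) r))

  -- Identifiers are raised by one to avoid the colour 0. The mark is set to unassigned for the
  -- partition, and Linial's steps do not touch it.
  start : ℕ → ℕ → ℕ → Reg
  start n Δ id = reg (suc id) (q Δ) 0 0

  accept : Reg → Bool
  accept R = mark R ≡ᵇ 2

  K : ℕ
  K = 2 + 3 * γ + r * (suc g + 1)

  length-program : ∀ n Δ → length (program n Δ) ≡ suc (logStar n + (q Δ * 1 + (q Δ * 2 + suc (r * (b Δ * 1 + 1)))))
  length-program n Δ = cong suc (trans (length-++ (linial Δ n n)) (cong₂ _+_ (length-linial Δ n n)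
    (trans (length-++ (partition e (q Δ) (W Δ))) (cong₂ _+_ (length-partition e (q Δ) (W Δ))
    (trans (length-++ (listColouring e (s Δ) Δ (q Δ))) (cong₂ _+_ (length-listColouring e (s Δ) Δ (q Δ)) (length-ruling (b Δ) r)))))))

  program-rounds : ∀ n Δ t → Δ ^ 2 ≤ t ^ (r + 2) → length (program n Δ) ≤ K * (1 + t) + logStar n
  program-rounds n Δ t Δ²≤ = begin
    length (program n Δ)                                                             ≡⟨ length-program n Δ ⟩
    suc (ℓ + (q Δ * 1 + (q Δ * 2 + suc (r * (suc g * T₁ Δ * 1 + 1)))))               ≤⟨ s≤s (+-monoʳ-≤ ℓ (+-mono-≤ (*-monoˡ-≤ 1 q≤γτ)
                                                                                          (+-mono-≤ (*-monoˡ-≤ 2 q≤γτ) (s≤s (*-monoʳ-≤ r (+-monoˡ-≤ 1 (*-monoˡ-≤ 1 (*-monoʳ-≤ (suc g) T₁≤τ)))))))) ⟩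
    suc (ℓ + (γ * τ * 1 + (γ * τ * 2 + suc (r * (suc g * τ * 1 + 1)))))              ≡⟨ lemma ℓ (γ * τ) (suc g * τ) r ⟩
    (2 + 3 * (γ * τ) + r * (suc g * τ)) + r + ℓ                                      ≤⟨ +-monoˡ-≤ ℓ (+-mono-≤ (+-monoˡ-≤ (r * (suc g * τ)) (+-monoˡ-≤ (3 * (γ * τ)) (m≤m*n 2 τ))) (m≤m*n r τ)) ⟩
    (2 * τ + 3 * (γ * τ) + r * (suc g * τ)) + r * τ + ℓ                              ≡⟨ cong (λ z → z + ℓ) (lemma′ γ (suc g) r τ) ⟩
    K * τ + ℓ ∎
    where
    open ≤-Reasoning
    τ ℓ : ℕ
    τ = suc t
    ℓ = logStar n
    T₁≤τ : T₁ Δ ≤ τ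
    T₁≤τ = s≤s (proj₂ (proj₂ (root Δ)) t Δ²≤)
    q≤γτ : q Δ ≤ γ * τ
    q≤γτ = ≤-trans (q≤ Δ) (*-monoʳ-≤ γ T₁≤τ)
    lemma : ∀ l a h r → suc (l + (a * 1 + (a * 2 + suc (r * (h * 1 + 1))))) ≡ (2 + 3 * a + r * h) + r + l
    lemma = solve-∀
    lemma′ : ∀ γ h r τ → (2 * τ + 3 * (γ * τ) + r * (h * τ)) + r * τ ≡ (2 + 3 * γ + r * (h + 1)) * τ
    lemma′ = solve-∀

  -- Exponents over Z = 2 ^ (1 + ⌈log₂ n⌉), which exceeds n and is at least 2, so that a constant k
  -- is at most Z ^ k. They bound the palettes, q and s², besides c for the identifiers and 1 for
  -- the mark 2; `B` exceeds each of them.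
  β₁ β₂ β₃ B : ℕ
  β₁ = (c₁ + 1 + 1) * 4
  β₂ = γ + 1
  β₃ = (suc g + 1) * r
  B  = suc (c + β₁ + β₂ + β₃ + 1)

  module _ (n : ℕ) where
    private
      Z : ℕ
      Z = 2 ^ (1 + ⌈log₂ n ⌉)

      2≤Z : 2 ≤ Z
      2≤Z = *-monoʳ-≤ 2 (m^n>0 2 ⌈log₂ n ⌉)

      n<Z : n < Z
      n<Z = ≤-<-trans (n≤2^⌈log₂n⌉ n) (^-monoʳ-< 2 (s≤s (s≤s z≤n)) (n<1+n ⌈log₂ n ⌉))

      constant≤ : ∀ k → k ≤ Z ^ k
      constant≤ k = ≤-trans (<⇒≤ (n<2^n k)) (^-monoˡ-≤ k 2≤Z)

      product≤ : ∀ {x y} i j → x ≤ Z ^ i → y ≤ Z ^ j → x * y ≤ Z ^ (i + j)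
      product≤ i j x≤ y≤ = ≤-trans (*-mono-≤ x≤ y≤) (≤-reflexive (sym (^-distribˡ-+-* Z i j)))

      power≤ : ∀ {x} i k → x ≤ Z ^ i → x ^ k ≤ Z ^ (i * k)
      power≤ i k x≤ = ≤-trans (^-monoˡ-≤ k x≤) (≤-reflexive (^-*-assoc Z i k))

      Z≤Z^1 : ∀ {x} → x ≤ Z → x ≤ Z ^ 1
      Z≤Z^1 le = ≤-trans le (≤-reflexive (sym (*-identityʳ Z)))

      Z^<capacity : ∀ {x} i → x ≤ Z ^ i → i < B → x < capacity B n
      Z^<capacity i x≤ i<B = <-≤-trans (≤-<-trans x≤ (^-monoʳ-< Z 2≤Z i<B))
        (≤-reflexive (trans (^-*-assoc 2 (1 + ⌈log₂ n ⌉) B) (cong (2 ^_) (*-comm (1 + ⌈log₂ n ⌉) B))))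

    n^c<capacity : n ^ c < capacity B n
    n^c<capacity = Z^<capacity c (^-monoˡ-≤ c (<⇒≤ n<Z))
      (s≤s (≤-trans (m≤m+n c β₁) (≤-trans (m≤m+n _ β₂) (≤-trans (m≤m+n _ β₃) (m≤m+n _ 1)))))

    2<capacity : 2 < capacity B n
    2<capacity = Z^<capacity 1 (Z≤Z^1 2≤Z) (s≤s (m≤n+m 1 _))

    module _ (Δ : ℕ) (Δ≤n : Δ ≤ n) where

      palette<capacity : ∀ {l} → l ≤ n → palette Δ l < capacity B n
      palette<capacity l≤n = Z^<capacity β₁ (power≤ (c₁ + 1 + 1) 4
        (product≤ (c₁ + 1) 1 (product≤ c₁ 1 (^-monoˡ-≤ c₁ 2≤Z) (Z≤Z^1 (≤-trans (s≤s Δ≤n) n<Z))) (Z≤Z^1 (≤-trans l≤n (<⇒≤ n<Z)))))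
        (s≤s (≤-trans (m≤n+m β₁ c) (≤-trans (m≤m+n _ β₂) (≤-trans (m≤m+n _ β₃) (m≤m+n _ 1)))))

      T₁≤Z : T₁ Δ ≤ Z
      T₁≤Z = ≤-trans (T₁≤sucΔ Δ) (≤-trans (s≤s Δ≤n) n<Z)

      q<capacity : q Δ < capacity B n
      q<capacity = Z^<capacity β₂ (≤-trans (q≤ Δ) (product≤ γ 1 (constant≤ γ) (Z≤Z^1 T₁≤Z)))
        (s≤s (≤-trans (m≤n+m β₂ (c + β₁)) (≤-trans (m≤m+n _ β₃) (m≤m+n _ 1))))

      ss<capacity : s Δ * s Δ < capacity B n
      ss<capacity = Z^<capacity β₃ (≤-trans (ss≤b^r Δ) (power≤ (suc g + 1) r (product≤ (suc g) 1 (constant≤ (suc g)) (Z≤Z^1 T₁≤Z))))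
        (s≤s (≤-trans (m≤n+m β₃ (c + β₁ + β₂)) (m≤m+n _ 1)))

  module _ {n : ℕ} (G : Graph n) (ports : Fin n → List (Fin n)) (numbering : IsPortNumbering G ports) (n≥1 : 1 ≤ n) where
    private
      N : ℕ
      N = capacity B n

    open Network G ports numbering N

    relax : ∀ {k m m′ X} → m ≤ m′ → Coloured k m X → Coloured k m′ X
    relax m≤m′ C = record
      { below = below ; hue-pos = hue-pos ; hue-≤ = λ v → ≤-trans (hue-≤ v) m≤m′ ; proper = proper ; mark-≡ = mark-≡ }
      where open Coloured C

    -- Since ⌊log₂ L⌋ < L, the bound `L ≤ suc fuel` persists, so fuel can only run out at L = 1.
    linial-leads : ∀ {k} fuel L X → 1 ≤ L → L ≤ suc fuel → L ≤ n → Coloured k (palette Δ L) X →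
      Leads ports N X (linial Δ fuel L) (Coloured k (palette Δ 1))
    linial-leads {k} zero       L X L≥1 L≤ L≤n C = subst (λ z → Coloured k (palette Δ z) X) (≤-antisym L≤ L≥1) C
    linial-leads {k} (suc fuel) L X L≥1 L≤ L≤n C with L ≤ᵇ 1 in eq
    ... | true  = subst (λ z → Coloured k (palette Δ z) X) (≤-antisym (≤ᵇ⇒≤ L 1 (≡⇒T eq)) L≥1) C
    ... | false = Coloured.below C , linial-leads fuel l _ l≥1 (≤-pred (≤-trans l<L L≤)) l≤n
        (relax (fitsOf Δ l l≥1) (linial-correct (degreeOf Δ l) (fieldOf Δ l) (isPrime _) (palette< Δ L)
          (≤-<-trans (*-monoʳ-≤ (degreeOf Δ l) (n≤1+n Δ)) (primeAbove> _))
          (≤-<-trans (fitsOf Δ l l≥1) (palette<capacity n Δ (maxDegree≤ G) l≤n)) X C))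
      where
      l : ℕ
      l = ⌊log₂ L ⌋
      l<L : l < L
      l<L = ⌊log₂n⌋<n L L≥1
      l≤n : l ≤ n
      l≤n = ≤-trans (<⇒≤ l<L) L≤n
      l≥1 : 1 ≤ l
      l≥1 = ⌊log₂n⌋≥1 L (≰⇒> λ le → true≢false (trans (sym (T⇒≡ (≤⇒≤ᵇ le))) eq))

    module _ (ids : Fin n → ℕ) (injective : ∀ {u v} → ids u ≡ ids v → u ≡ v) (ids<n^c : ∀ v → ids v < n ^ c) where

      X₀ : Fin n → Reg
      X₀ v = start n Δ (ids v)

      Δ≤n : Δ ≤ n
      Δ≤n = maxDegree≤ G

      initial : Coloured (q Δ) (n ^ c) X₀
      initial = record
        { below   = λ v → ≤-<-trans (ids<n^c v) (n^c<capacity n) , q<capacity n Δ Δ≤n , positive , positive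
        ; hue-pos = λ v → s≤s z≤n
        ; hue-≤   = ids<n^c
        ; proper  = λ v u i e → loopless v (subst (_∈ ports v) (sym (injective (suc-injective e))) i)
        ; mark-≡  = λ v → refl
        }
        where
        positive : 0 < N
        positive = <-trans (s≤s z≤n) (2<capacity n)
        loopless : ∀ v → ¬ (v ∈ ports v)
        loopless v i = true≢false (trans (sym (∈ports⇒adj G ports numbering i)) (irrefl G v))

      program-leads : Leads ports N X₀ (program n Δ) (λ X → IsRulingSet G r (accept ∘ X))
      program-leads =
        Coloured.below initial ,
        leads-++ ports (linial Δ n n) _
          (linial-leads n n _ n≥1 (n≤1+n n) ≤-refl
            (relax (fits₀ n Δ n≥1) (linial-correct (degree₀ n) (field₀ n Δ) (isPrime _) (ids< n Δ)
              (≤-<-trans (*-monoʳ-≤ (degree₀ n) (n≤1+n Δ)) (primeAbove> _))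
              (≤-<-trans (fits₀ n Δ n≥1) (palette<capacity n Δ Δ≤n ≤-refl)) X₀ initial))) λ X₁ C₁ →
        leads-++ ports (partition e (q Δ) (W Δ)) _
          (partition-correct e (q Δ) (W Δ) (palette Δ 1) (isPrime _) (palette<q^e Δ) (few-conflicts Δ) (q<capacity n Δ Δ≤n) X₁ C₁) λ X₂ C₂ →
        leads-++ ports (listColouring e (s Δ) Δ (q Δ)) _
          (listColouring-correct G ports numbering N e (s Δ) (q Δ) (W Δ) (palette Δ 1) (isPrime _) (palette<s^e Δ) (room Δ) (ss<capacity n Δ Δ≤n) X₂ C₂) λ X₃ C₃ →
        ruling-correct G ports numbering N (b Δ) r (2<capacity n) X₃ (Final.below C₃)
          (λ v → <-≤-trans (Final.hue-< C₃ v) (ss≤b^r Δ)) (Final.proper C₃)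

ruling-set-cong : ∀ {n} (G : Graph n) r {S S′ : Fin n → Bool} → (∀ v → S v ≡ S′ v) → IsRulingSet G r S′ → IsRulingSet G r S
ruling-set-cong G r eq (independent , dominating) =
  (λ u v su sv → independent u v (trans (sym (eq u)) su) (trans (sym (eq v)) sv)) ,
  λ v → proj₁ (dominating v) , trans (eq _) (proj₁ (proj₂ (dominating v))) , proj₂ (proj₂ (dominating v))

theorem4 : (r : ℕ) → 2 ≤ r → (c : ℕ) → 1 ≤ c →
    Σ ℕ λ K → Σ ℕ λ B → Σ CongestAlg λ A →
    (n : ℕ) (G : Graph n) (ids : Fin n → ℕ) →
    Injective _≡_ _≡_ ids → (∀ v → ids v < n ^ c) →
    (ports : Fin n → List (Fin n)) → IsPortNumbering G ports →
    BandwidthOK A G ids ports B (rounds A n (maxDegree G)) ×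
    IsRulingSet G r (finalOutput A G ids ports) ×
    (∀ t → maxDegree G ^ 2 ≤ t ^ (r + 2) →
    rounds A n (maxDegree G) ≤ K * (1 + t) + logStar n)
theorem4 r 2≤r c _ = K , 4 * B , simulate B program start accept , correct
  where
  open Parameters (proj₁ next-prime) (proj₂ next-prime) r 2≤r c
  correct : (n : ℕ) (G : Graph n) (ids : Fin n → ℕ) →
    Injective _≡_ _≡_ ids → (∀ v → ids v < n ^ c) →
    (ports : Fin n → List (Fin n)) → IsPortNumbering G ports →
    BandwidthOK (simulate B program start accept) G ids ports (4 * B) (length (program n (maxDegree G))) ×
    IsRulingSet G r (finalOutput (simulate B program start accept) G ids ports) ×
    (∀ t → maxDegree G ^ 2 ≤ t ^ (r + 2) → length (program n (maxDegree G)) ≤ K * (1 + t) + logStar n)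
  correct n G ids injective ids< ports numbering =
    simulate-bandwidth B program start accept G ids ports leads ,
    ruled (simulate-output B program start accept G ids ports leads) ,
    program-rounds n (maxDegree G)
    where
    leads : Leads ports (capacity B n) (λ v → start n (maxDegree G) (ids v)) (program n (maxDegree G)) (λ X → IsRulingSet G r (accept ∘ X))
    leads = cases n G ids injective ids< ports numbering
      where
      cases : (n : ℕ) (G : Graph n) (ids : Fin n → ℕ) → Injective _≡_ _≡_ ids → (∀ v → ids v < n ^ c) →
        (ports : Fin n → List (Fin n)) → IsPortNumbering G ports →
        Leads ports (capacity B n) (λ v → start n (maxDegree G) (ids v)) (program n (maxDegree G)) (λ X → IsRulingSet G r (accept ∘ X))
      cases zero    G ids injective ids< ports numbering = leads-empty ports (program 0 (maxDegree G)) _ λ Y → (λ ()) , λ ()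
      cases (suc n) G ids injective ids< ports numbering = program-leads G ports numbering (s≤s z≤n) ids injective ids<
    ruled : ∃ (λ X → IsRulingSet G r (accept ∘ X) × (∀ v → finalOutput (simulate B program start accept) G ids ports v ≡ accept (X v))) →
      IsRulingSet G r (finalOutput (simulate B program start accept) G ids ports)
    ruled (X , ruling-set , eq) = ruling-set-cong G r eq ruling-set
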